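{- Let $\langle W, < \rangle$ be a strict linear order containing an infinite ascending chain of pairwise distinct elements of $W$. Let $\leqslant$ be the reflexive closure of $<$ and $R$ a binary relation on $W$ with ${<}\subseteq R\subseteq{\leqslant}$. Let $L$ be a logic (set of formulas) such that $\mathbf{L}(W, R) \subseteq L \subseteq \mathbf{L}_{c}(W, R)$. Then satisfiability for $L$ is $\Pi^0_1$-hard—hence $L$ is $\Sigma^0_1$-hard—in languages with two individual variables, one monadic predicate letter and one proposition letter; that is, the set of formulas $\varphi$ containing only two individual variables, a single monadic predicate letter and a single proposition letter with $\neg\varphi\notin L$ is $\Pi^0_1$-hard, and the set of such formulas belonging to $L$ is $\Sigma^0_1$-hard.
   Context: First-order (predicate) modal language: countably many individual variables, predicate letters of every arity (nullary ones are proposition letters), no constants or function symbols, $\bot$, $\to$, $\Box$, $\forall$; other connectives, $\exists$, $\Diamond$ defined as usual. A predicate frame with expanding domains over a Kripke frame $\langle W,R\rangle$ is $\langle W,R,D\rangle$ with non-empty sets $D_w$ such that $wRw'$ implies $D_w\subseteq D_{w'}$; constant domain if all $D_w$ coincide. A model adds $I(w,P)\subseteq D_w^n$ for each $n$-ary letter $P$. Truth: atoms via $I(w,\cdot)$; Boolean connectives classically; $w\models^g\Box\varphi$ iff $v\models^g\varphi$ for all $R$-successors $v$ of $w$; $w\models^g\forall x\,\varphi$ iff $w\models^{g'}\varphi$ for all $x$-variants $g'$ of $g$ with $g'(x)\in D_w$. A formula is true at $w$ if true under all assignments sending its free variables into $D_w$. $\mathbf{L}(W,R)$ (resp. $\mathbf{L}_c(W,R)$)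 is the set of formulas true at all worlds of all models based on predicate frames with expanding (resp. constant) domains over $\langle W,R\rangle$. Satisfiability for $L$ is the set of $\varphi$ with $\neg\varphi\notin L$. -}

module Defs where

open import Level using (Level; _⊔_) renaming (suc to lsuc; zero to lzero)
open import Data.Nat using (ℕ; zero; suc; _+_; _*_; _^_; _<_; _≡ᵇ_)
open import Data.Fin using (Fin)
open import Data.Vec using (Vec; []; _∷_; lookup; map)
open import Data.Vec.Relation.Unary.All using (All)
open import Data.Vec.Membership.Propositional using (_∈_)
open import Data.Bool using (if_then_else_)
open import Data.Product using (Σ; ∃; _×_; _,_)
open import Data.Sum using (_⊎_)
open import Relation.Nullary using (¬_)
open import Relation.Binary using (Rel; IsStrictPartialOrder)
open import Relation.Binary.PropositionalEquality using (_≡_; _≢_)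
open import Function.Bundles using (_⇔_)

-- Syntax of the first-order modal language.
-- Individual variables are ℕ; predicate letters are indexed by
-- (arity n, index P); nullary letters are proposition letters.

data Form : Set where
  atom : (n P : ℕ) → Vec ℕ n → Form
  ⊥'   : Form
  _⇒_  : Form → Form → Form
  □    : Form → Form
  ∀'   : ℕ → Form → Form

infixr 5 _⇒_

¬' : Form → Form
¬' φ = φ ⇒ ⊥'

data FreeIn (x : ℕ) : Form → Set where
  f-atom : ∀ {n P xs} → x ∈ xs → FreeIn x (atom n P xs)
  f-⇒ˡ   : ∀ {φ ψ} → FreeIn x φ → FreeIn x (φ ⇒ ψ)
  f-⇒ʳ   : ∀ {φ ψ} → FreeIn x ψ → FreeIn x (φ ⇒ ψ)
  f-□    : ∀ {φ} → FreeIn x φ → FreeIn x (□ φ)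
  f-∀    : ∀ {y φ} → x ≢ y → FreeIn x φ → FreeIn x (∀' y φ)

record PFrame (W : Set) (R : Rel W lzero) : Set₁ where
  field
    U        : Set
    D        : W → U → Set
    nonempty : ∀ w → ∃ λ d → D w d
    expand   : ∀ {w v} → R w v → ∀ {d} → D w d → D v d

ConstantDomain : ∀ {W R} → PFrame W R → Set
ConstantDomain F = ∀ w v d → D w d → D v d
  where open PFrame F

record Model {W : Set} {R : Rel W lzero} (F : PFrame W R) : Set₁ where
  open PFrame F
  field
    I     : W → (n P : ℕ) → Vec U n → Set
    I-dom : ∀ {w n P ds} → I w n P ds → All (D w) ds

module _ {W : Set} {R : Rel W lzero} {F : PFrame W R} (M : Model F) where
  open PFrame F
  open Model M

  _[_≔_] : (ℕ → U) → ℕ → U → (ℕ → U)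
  (g [ x ≔ d ]) y = if y ≡ᵇ x then d else g y

  Sat : W → (ℕ → U) → Form → Set
  Sat w g (atom n P xs) = I w n P (map g xs)
  Sat w g ⊥'            = Data.Empty.⊥ where import Data.Empty
  Sat w g (φ ⇒ ψ)       = Sat w g φ → Sat w g ψ
  Sat w g (□ φ)         = ∀ v → R w v → Sat v g φ
  Sat w g (∀' x φ)      = ∀ d → D w d → Sat w (g [ x ≔ d ]) φ

  TrueAt : W → Form → Set
  TrueAt w φ = ∀ (g : ℕ → U) → (∀ x → FreeIn x φ → D w (g x)) → Sat w g φ

LogicExp : (W : Set) (R : Rel W lzero) → Form → Set₁
LogicExp W R φ = ∀ (F : PFrame W R) (M : Model F) (w : W) → TrueAt M w φ

LogicConst : (W : Set) (R : Rel W lzero) → Form → Set₁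
LogicConst W R φ = ∀ (F : PFrame W R) → ConstantDomain F →
                   ∀ (M : Model F) (w : W) → TrueAt M w φ

IsVar01 : ℕ → Set
IsVar01 x = x ≡ 0 ⊎ x ≡ 1

InLang : Form → Set
InLang (atom 0 0 [])          = Data.Unit.⊤ where import Data.Unit
InLang (atom 1 0 (x ∷ []))    = IsVar01 x
InLang (atom _ _ _)           = Data.Empty.⊥ where import Data.Empty
InLang ⊥'                     = Data.Unit.⊤ where import Data.Unit
InLang (φ ⇒ ψ)                = InLang φ × InLang ψ
InLang (□ φ)                  = InLang φ
InLang (∀' x φ)               = IsVar01 x × InLang φ

data PR : ℕ → Set where
  Z    : ∀ {n} → PR n
  S    : PR 1
  Proj : ∀ {n} → Fin n → PR n
  Comp : ∀ {n m} → PR m → Vec (PR n) m → PR n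
  Rec  : ∀ {n} → PR n → PR (suc (suc n)) → PR (suc n)
  Mu   : ∀ {n} → PR (suc n) → PR n

mutual
  data Eval : ∀ {n} → PR n → Vec ℕ n → ℕ → Set where
    ev-Z    : ∀ {n} {xs : Vec ℕ n} → Eval Z xs 0
    ev-S    : ∀ {x} → Eval S (x ∷ []) (suc x)
    ev-Proj : ∀ {n} {i : Fin n} {xs} → Eval (Proj i) xs (lookup xs i)
    ev-Comp : ∀ {n m} {f : PR m} {gs : Vec (PR n) m} {xs ys y} →
              EvalAll gs xs ys → Eval f ys y → Eval (Comp f gs) xs y
    ev-Rec0 : ∀ {n} {f : PR n} {g} {xs y} →
              Eval f xs y → Eval (Rec f g) (0 ∷ xs) y
    ev-RecS : ∀ {n} {f : PR n} {g} {k xs r y} →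
              Eval (Rec f g) (k ∷ xs) r → Eval g (k ∷ r ∷ xs) y →
              Eval (Rec f g) (suc k ∷ xs) y
    ev-Mu   : ∀ {n} {f : PR (suc n)} {xs y} →
              Eval f (y ∷ xs) 0 →
              (∀ z → z < y → ∃ λ m → Eval f (z ∷ xs) (suc m)) →
              Eval (Mu f) xs y

  data EvalAll {n} : ∀ {m} → Vec (PR n) m → Vec ℕ n → Vec ℕ m → Set where
    [] : ∀ {xs} → EvalAll [] xs []
    _∷_ : ∀ {m g y} {gs : Vec (PR n) m} {xs ys} →
          Eval g xs y → EvalAll gs xs ys → EvalAll (g ∷ gs) xs (y ∷ ys)

Computable : (ℕ → ℕ) → Set
Computable f = ∃ λ (e : PR 1) → ∀ n → Eval e (n ∷ []) (f n)

Sigma01 : ∀ {a} → (ℕ → Set a) → Set a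
Sigma01 A = ∃ λ (e : PR 1) → ∀ n → A n ⇔ (∃ λ y → Eval e (n ∷ []) y)

Pi01 : ∀ {a} → (ℕ → Set a) → Set a
Pi01 A = ∃ λ (e : PR 1) → ∀ n → A n ⇔ (¬ ∃ λ y → Eval e (n ∷ []) y)

pair : ℕ → ℕ → ℕ
pair a b = 2 ^ a * (2 * b + 1)

encVec : ∀ {n} → Vec ℕ n → ℕ
encVec []       = 0
encVec (x ∷ xs) = suc (pair x (encVec xs))

encode : Form → ℕ
encode (atom n P xs) = pair 0 (pair n (pair P (encVec xs)))
encode ⊥'            = pair 1 0
encode (φ ⇒ ψ)       = pair 2 (pair (encode φ) (encode ψ))
encode (□ φ)         = pair 3 (encode φ)
encode (∀' x φ)      = pair 4 (pair x (encode φ))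

_≤m_ : ∀ {a b} → (ℕ → Set a) → (Form → Set b) → Set (a ⊔ b)
A ≤m X = ∃ λ (f : ℕ → Form) → Computable (λ n → encode (f n)) ×
           (∀ n → A n ⇔ X (f n))

Pi01Hard : ∀ {b} → (Form → Set b) → Set (lsuc lzero ⊔ b)
Pi01Hard X = ∀ (A : ℕ → Set) → Pi01 A → A ≤m X

Sigma01Hard : ∀ {b} → (Form → Set b) → Set (lsuc lzero ⊔ b)
Sigma01Hard X = ∀ (A : ℕ → Set) → Sigma01 A → A ≤m X

IsStrictLinearOrder : {W : Set} → Rel W lzero → Set
IsStrictLinearOrder {W} _<_ =
  IsStrictPartialOrder _≡_ _<_ × (∀ x y → x ≢ y → x < y ⊎ y < x)

ReflClosure : {W : Set} → Rel W lzero → Rel W lzero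
ReflClosure _<_ x y = x < y ⊎ x ≡ y

HasInfiniteAscendingChain : {W : Set} → Rel W lzero → Set
HasInfiniteAscendingChain {W} _<_ =
  ∃ λ (c : ℕ → W) → (∀ i → c i < c (suc i)) × (∀ i j → c i ≡ c j → i ≡ j)

{-# OPTIONS --safe #-}

-- A μ-recursive program is compiled to a register machine, and "the axioms of the machine and the
-- existence of a start configuration imply F" is a formula that is valid iff the machine halts.
--
-- A world is identified with the extension of the monadic letter P at it. In the canonical model the
-- worlds of the ascending chain run through three families of sets, each set recurring infinitely often,
-- so that □ on the chain quantifies over all of them, as in S5. Elements are cells (i , w), read "register
-- i holds w", and names of configurations. The downsets { (i , w) | w ≤ m }, marked by the proposition
-- letter p, define the order of the values; the rows tell the registers apart; the remaining sets are the
-- configurations of the run. Elsewhere P is empty, and quantifiers guarded by P ignore those worlds.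
--
-- Falsum is replaced throughout by F = □ p (Friedman's translation), which persists along R. Where p means
-- "downset, or the machine halts", F amounts to halting on the chain; hence validity yields an actual
-- halting computation, which Σ⁰₁-hardness demands constructively, and Π⁰₁-hardness follows by negation.

module Submission where

open import Defs
open import Level using (Level)
open import Data.Bool using (if_then_else_; true; false)
open import Data.Empty using (⊥; ⊥-elim)
open import Data.Fin using (zero; suc)
open import Data.List using (List; []; _∷_; _++_; length)
open import Data.List.Properties using (length-++)
open import Data.Maybe using (Maybe; just; nothing; maybe′)
open import Data.Nat as ℕ hiding (less)
open import Data.Nat.Induction using (<-wellFounded)
open import Data.Nat.Properties
open import Data.Product using (∃; ∃-syntax; _×_; _,_; proj₁; proj₂)
open import Data.Sum using (_⊎_; inj₁; inj₂)
open import Data.Unit using (⊤; tt)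
open import Data.Vec using (Vec; []; _∷_; lookup; map)
open import Data.Vec.Properties using (lookup-map)
open import Data.Vec.Relation.Unary.All as All using (All; []; _∷_)
open import Function.Bundles using (_⇔_; mk⇔; Equivalence)
open import Induction.WellFounded using (Acc; acc)
open import Relation.Binary using (Rel; IsStrictPartialOrder)
open import Relation.Binary.PropositionalEquality
open import Relation.Nullary using (¬_; does)
open import Relation.Nullary.Decidable using (dec-true; dec-false)

-- Computable functions

Computable₂ : (ℕ → ℕ → ℕ) → Set
Computable₂ f = ∃ λ (e : PR 2) → ∀ a b → Eval e (a ∷ b ∷ []) (f a b)

constant : ∀ {n} → ℕ → PR n
constant zero    = Z
constant (suc c) = Comp S (constant c ∷ [])

eval-constant : ∀ {n} c {xs} → Eval (constant {n} c) xs c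
eval-constant zero    = ev-Z
eval-constant (suc c) = ev-Comp (eval-constant c ∷ []) ev-S

computable-const : ∀ c → Computable (λ _ → c)
computable-const c = constant c , λ _ → eval-constant c

computable-id : Computable (λ n → n)
computable-id = Proj zero , λ _ → ev-Proj

computable-∘ : ∀ {f g} → Computable g → Computable f → Computable (λ n → g (f n))
computable-∘ {f} (d , q) (e , p) = Comp d (e ∷ []) , λ n → ev-Comp (p n ∷ []) (q (f n))

computable-∘₂ : ∀ {h f g} → Computable₂ h → Computable f → Computable g → Computable (λ n → h (f n) (g n))
computable-∘₂ {f = f} {g} (c , r) (d , p) (e , q) =
  Comp c (d ∷ e ∷ []) , λ n → ev-Comp (p n ∷ q n ∷ []) (r (f n) (g n))

computable-+ : Computable₂ _+_
computable-+ = Rec (Proj zero) (Comp S (Proj (suc zero) ∷ [])) , eval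
  where
  eval : ∀ a b → Eval (Rec (Proj zero) (Comp S (Proj (suc zero) ∷ []))) (a ∷ b ∷ []) (a + b)
  eval zero    b = ev-Rec0 ev-Proj
  eval (suc a) b = ev-RecS (eval a b) (ev-Comp (ev-Proj ∷ []) ev-S)

computable-* : Computable₂ _*_
computable-* with computable-+
... | plus , eval-plus = times , eval
  where
  times = Rec Z (Comp plus (Proj (suc (suc zero)) ∷ Proj (suc zero) ∷ []))
  eval : ∀ a b → Eval times (a ∷ b ∷ []) (a * b)
  eval zero    b = ev-Rec0 ev-Z
  eval (suc a) b = ev-RecS (eval a b) (ev-Comp (ev-Proj ∷ ev-Proj ∷ []) (eval-plus b (a * b)))

-- Primitive recursion without parameters: the step receives the counter and the previous value, and
-- passes on only the latter.
computable-iterate : ∀ {h} (a : ℕ → ℕ) → Computable h → (∀ n → a (suc n) ≡ h (a n)) → Computable a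
computable-iterate a (e , p) a-suc = Rec (constant (a 0)) g , eval
  where
  g = Comp e (Proj (suc zero) ∷ [])
  eval : ∀ n → Eval (Rec (constant (a 0)) g) (n ∷ []) (a n)
  eval zero    = ev-Rec0 (eval-constant (a 0))
  eval (suc n) = ev-RecS (eval n) (subst (Eval g _) (sym (a-suc n)) (ev-Comp (ev-Proj ∷ []) (p (a n))))

computable-pair : ∀ {f g} → Computable f → Computable g → Computable (λ n → pair (f n) (g n))
computable-pair p q =
  computable-∘₂ computable-*
    (computable-∘ (computable-iterate (2 ^_) (computable-∘₂ computable-* (computable-const 2) computable-id)
                                      (λ _ → refl)) p)
    (computable-∘₂ computable-+ (computable-∘₂ computable-* (computable-const 2) q) (computable-const 1))

-- A formula with a hole, tracked on codes: `code` acts on the code of the filling, so nothing is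
-- ever decoded. The constructors of formulas lift to such operations.
record ComputableOp (T : Form → Form) : Set where
  constructor computableOp
  field
    code        : ℕ → ℕ
    computable  : Computable code
    encode-code : ∀ φ → encode (T φ) ≡ code (encode φ)

op-id : ComputableOp (λ φ → φ)
op-id = computableOp (λ n → n) computable-id (λ _ → refl)

op-const : ∀ ψ → ComputableOp (λ _ → ψ)
op-const ψ = computableOp (λ _ → encode ψ) (computable-const (encode ψ)) (λ _ → refl)

op-⇒ : ∀ {T U} → ComputableOp T → ComputableOp U → ComputableOp (λ φ → T φ ⇒ U φ)
op-⇒ (computableOp h c p) (computableOp k d q) =
  computableOp (λ n → pair 2 (pair (h n) (k n))) (computable-pair (computable-const 2) (computable-pair c d))
    (λ φ → cong₂ (λ a b → pair 2 (pair a b)) (p φ) (q φ))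

op-□ : ∀ {T} → ComputableOp T → ComputableOp (λ φ → □ (T φ))
op-□ (computableOp h c p) =
  computableOp (λ n → pair 3 (h n)) (computable-pair (computable-const 3) c) (λ φ → cong (pair 3) (p φ))

op-∀ : ∀ {T} x → ComputableOp T → ComputableOp (λ φ → ∀' x (T φ))
op-∀ x (computableOp h c p) =
  computableOp (λ n → pair 4 (pair x (h n)))
    (computable-pair (computable-const 4) (computable-pair (computable-const x) c))
    (λ φ → cong (λ a → pair 4 (pair x a)) (p φ))

-- A record rather than a synonym: unfolding encode during type checking is exponentially expensive.
record ComputableForms (φ : ℕ → Form) : Set where
  constructor computableForms
  field
    computable : Computable (λ n → encode (φ n))

reduction : ∀ {a b} {A : ℕ → Set a} (X : Form → Set b) (f : ℕ → Form) → ComputableForms f →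
            (∀ n → A n ⇔ X (f n)) → A ≤m X
reduction X f (computableForms c) A⇔X = f , c , A⇔X

forms-iterate : ∀ {T} (φ : ℕ → Form) → ComputableOp T → (∀ n → φ (suc n) ≡ T (φ n)) → ComputableForms φ
forms-iterate φ (computableOp h c p) φ-suc = computableForms
  (computable-iterate (λ n → encode (φ n)) c (λ n → trans (cong encode (φ-suc n)) (p (φ n))))

forms-op : ∀ {T φ} → ComputableOp T → ComputableForms φ → ComputableForms (λ n → T (φ n))
forms-op {φ = φ} (computableOp h c p) (computableForms d) with computable-∘ c d
... | e , q = computableForms (e , λ n → subst (Eval e _) (sym (p (φ n))) (q n))

-- Register machines

data Source : Set where
  zeroS : Source
  copy  : ℕ → Source
  incr  : ℕ → Source

data Instr : Set where
  set : (j : ℕ) → Source → (next : ℕ) → Instr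
  djz : (i ifzero next : ℕ) → Instr

Registers : Set
Registers = ℕ → ℕ

State : Set
State = ℕ × Registers

infixl 20 _[_↦_]
_[_↦_] : Registers → ℕ → ℕ → Registers
(ρ [ j ↦ v ]) i = if does (i ≟ j) then v else ρ i

source : Source → Registers → ℕ
source zeroS    ρ = 0
source (copy i) ρ = ρ i
source (incr i) ρ = suc (ρ i)

decrement : ℕ → (ifzero next i : ℕ) → Registers → State
decrement zero    a b i ρ = a , ρ
decrement (suc v) a b i ρ = b , ρ [ i ↦ v ]

exec : Instr → Registers → State
exec (set j s a) ρ = a , ρ [ j ↦ source s ρ ]
exec (djz i a b) ρ = decrement (ρ i) a b i ρ

fetch : List Instr → ℕ → Maybe Instr
fetch []      _       = nothing
fetch (i ∷ Π) zero    = just i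
fetch (i ∷ Π) (suc a) = fetch Π a

step : List Instr → State → State
-- The default keeps the state: outside the program the machine idles.
step Π (a , ρ) = maybe′ (λ i → exec i ρ) (a , ρ) (fetch Π a)

run : List Instr → ℕ → State → State
run Π zero    c = c
run Π (suc N) c = run Π N (step Π c)

run-suc : ∀ Π N c → run Π (suc N) c ≡ step Π (run Π N c)
run-suc Π zero    c = refl
run-suc Π (suc N) c = run-suc Π N (step Π c)

HaltsIn : List Instr → ℕ → State → Set
HaltsIn Π N c = proj₁ (run Π N c) ≡ length Π

fetch-length : ∀ Π → fetch Π (length Π) ≡ nothing
fetch-length []      = refl
fetch-length (_ ∷ Π) = fetch-length Π

↦-same : ∀ ρ j v → (ρ [ j ↦ v ]) j ≡ v
↦-same ρ j v rewrite dec-true (j ≟ j) refl = refl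

↦-other : ∀ ρ {i j} v → i ≢ j → (ρ [ j ↦ v ]) i ≡ ρ i
↦-other ρ {i} {j} v i≢j rewrite dec-false (i ≟ j) i≢j = refl

-- Code fragments and the compiler.

At : List Instr → ℕ → List Instr → Set
At Π s []       = ⊤
At Π s (i ∷ is) = fetch Π s ≡ just i × At Π (suc s) is

At-suc : ∀ {Π i} s is → At Π s is → At (i ∷ Π) (suc s) is
At-suc s []       _       = tt
At-suc s (_ ∷ is) (p , q) = p , At-suc (suc s) is q

At-self : ∀ Π → At Π 0 Π
At-self []      = tt
At-self (_ ∷ Π) = refl , At-suc 0 Π (At-self Π)

At-++ : ∀ {Π} s is {js} → At Π s (is ++ js) → At Π s is × At Π (length is + s) js
At-++ s []       q       = tt , q
At-++ {Π} s (i ∷ is) {js} (p , q) with At-++ (suc s) is q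
... | q₁ , q₂ = (p , q₁) , subst (λ t → At Π t js) (+-suc (length is) s) q₂

-- Independent of registers and labels, so that `compile` can compute jump targets before the code
-- they point to exists.
size    : ∀ {n} → PR n → ℕ
sizeAll : ∀ {n m} → Vec (PR n) m → ℕ
size Z           = 1
size S           = 1
size (Proj _)    = 1
size (Comp f gs) = sizeAll gs + size f
size (Rec f g)   = 2 + (size f + (1 + (size g + 3)))
size (Mu f)      = 1 + (size f + 3)
sizeAll []       = 0
sizeAll (g ∷ gs) = size g + sizeAll gs

interval : ℕ → (m : ℕ) → Vec ℕ m
interval r zero    = []
interval r (suc m) = r ∷ interval (suc r) m

-- Registers from b on are scratch space; s is the position of the code, and x the label it exits to.
compile    : ∀ {n} → PR n → Vec ℕ n → (out b s x : ℕ) → List Instr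
compileAll : ∀ {n m} → Vec (PR n) m → Vec ℕ n → (out b s : ℕ) → List Instr
compile Z        ins       o b s x = set o zeroS x ∷ []
compile S        (i ∷ [])  o b s x = set o (incr i) x ∷ []
compile (Proj i) ins       o b s x = set o (copy (lookup ins i)) x ∷ []
compile (Comp {m = m} f gs) ins o b s x =
  compileAll gs ins b (m + b) s ++ compile f (interval b m) o (m + b) (sizeAll gs + s) x
-- Register `b` counts the remaining rounds down, `1 + b` the completed ones up, `2 + b`
-- accumulates, and `3 + b` receives the value of `g`. The loop head is `l`; the loop leaves to
-- `2 + q`.
compile (Rec f g) (k ∷ ins) o b s x =
  set b (copy k) (1 + s) ∷ set (1 + b) zeroS (2 + s) ∷
  compile f ins (2 + b) (4 + b) (2 + s) l ++
  (djz b (2 + q) (suc l) ∷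
   compile g (1 + b ∷ 2 + b ∷ ins) (3 + b) (4 + b) (suc l) q ++
   (set (2 + b) (copy (3 + b)) (1 + q) ∷ set (1 + b) (incr (1 + b)) l ∷
    set o (copy (2 + b)) x ∷ []))
  where
  l = size f + (2 + s)
  q = size g + suc l
-- Register `b` holds the candidate and `1 + b` the value of `f`; the decrementing jump serves as
-- zero test.
compile (Mu f) ins o b s x =
  set b zeroS (1 + s) ∷
  compile f (b ∷ ins) (1 + b) (2 + b) (1 + s) l ++
  (djz (1 + b) (2 + l) (1 + l) ∷ set b (incr b) (1 + s) ∷ set o (copy b) x ∷ [])
  where
  l = size f + (1 + s)
compileAll []       ins o b s = []
compileAll (g ∷ gs) ins o b s =
  compile g ins o b s (size g + s) ++ compileAll gs ins (suc o) b (size g + s)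

length-compile    : ∀ {n} (e : PR n) ins o b s x → length (compile e ins o b s x) ≡ size e
length-compileAll : ∀ {n m} (gs : Vec (PR n) m) ins o b s →
                    length (compileAll gs ins o b s) ≡ sizeAll gs
length-compile Z        ins      o b s x = refl
length-compile S        (_ ∷ []) o b s x = refl
length-compile (Proj _) ins      o b s x = refl
length-compile (Comp {m = m} f gs) ins o b s x =
  trans (length-++ (compileAll gs ins b (m + b) s))
        (cong₂ _+_ (length-compileAll gs ins b (m + b) s) (length-compile f _ o _ _ x))
length-compile (Rec f g) (k ∷ ins) o b s x =
  cong (2 +_) (trans (length-++ (compile f ins _ _ _ _))
    (cong₂ _+_ (length-compile f ins _ _ _ _)
      (cong suc (trans (length-++ (compile g _ _ _ _ _))
        (cong (_+ 3) (length-compile g _ _ _ _ _))))))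
length-compile (Mu f) ins o b s x =
  cong suc (trans (length-++ (compile f _ _ _ _ _)) (cong (_+ 3) (length-compile f _ _ _ _ _)))
length-compileAll []       ins o b s = refl
length-compileAll (g ∷ gs) ins o b s =
  trans (length-++ (compile g ins o b s _))
        (cong₂ _+_ (length-compile g ins o b s _) (length-compileAll gs ins _ b _))

At-compile : ∀ {Π n} (e : PR n) ins o b s x {js} → At Π s (compile e ins o b s x ++ js) →
             At Π s (compile e ins o b s x) × At Π (size e + s) js
At-compile {Π} e ins o b s x {js} q with At-++ s (compile e ins o b s x) q
... | q₁ , q₂ = q₁ , subst (λ t → At Π (t + s) js) (length-compile e ins o b s x) q₂

At-compileAll : ∀ {Π n m} (gs : Vec (PR n) m) ins o b s {js} → At Π s (compileAll gs ins o b s ++ js) →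
                At Π s (compileAll gs ins o b s) × At Π (sizeAll gs + s) js
At-compileAll {Π} gs ins o b s {js} q with At-++ s (compileAll gs ins o b s) q
... | q₁ , q₂ = q₁ , subst (λ t → At Π (t + s) js) (length-compileAll gs ins o b s) q₂

Agree : ℕ → Registers → Registers → Set
Agree b ρ ρ′ = ∀ r → r < b → ρ′ r ≡ ρ r

-- Compiled code writes to its output register `o` and to the scratch space from `b` on, and nowhere
-- else.
Frame : ℕ → ℕ → Registers → Registers → Set
Frame b o ρ ρ′ = ∀ r → r < b → r ≢ o → ρ′ r ≡ ρ r

Agree-trans : ∀ {b ρ₁ ρ₂ ρ₃} → Agree b ρ₁ ρ₂ → Agree b ρ₂ ρ₃ → Agree b ρ₁ ρ₃
Agree-trans p q r r<b = trans (q r r<b) (p r r<b)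

Agree-↦ : ∀ {b j} ρ v → b ≤ j → Agree b ρ (ρ [ j ↦ v ])
Agree-↦ ρ v b≤j r r<b = ↦-other ρ v (<⇒≢ (≤-trans r<b b≤j))

Frame-Agree : ∀ {b b′ o ρ ρ′} → b ≤ b′ → b ≤ o → Frame b′ o ρ ρ′ → Agree b ρ ρ′
Frame-Agree b≤b′ b≤o p r r<b = p r (≤-trans r<b b≤b′) (<⇒≢ (≤-trans r<b b≤o))

Frame-↦ : ∀ {b o ρ ρ′} v → Agree b ρ ρ′ → Frame b o ρ (ρ′ [ o ↦ v ])
Frame-↦ {ρ′ = ρ′} v p r r<b r≢o = trans (↦-other ρ′ v r≢o) (p r r<b)

map-Agree : ∀ {b n ρ ρ′} {ins : Vec ℕ n} → All (_< b) ins → Agree b ρ ρ′ → map ρ′ ins ≡ map ρ ins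
map-Agree []       p = refl
map-Agree (q ∷ qs) p = cong₂ _∷_ (p _ q) (map-Agree qs p)

All-≤ : ∀ {b b′ n} {ins : Vec ℕ n} → b ≤ b′ → All (_< b) ins → All (_< b′) ins
All-≤ b≤b′ = All.map (λ r<b → ≤-trans r<b b≤b′)

interval-< : ∀ r m → All (_< m + r) (interval r m)
interval-< r zero    = []
interval-< r (suc m) = s≤s (m≤n+m r m) ∷ subst (λ t → All (_< t) (interval (suc r) m)) (+-suc m r)
                                              (interval-< (suc r) m)

sizeAll-∷ : ∀ {n m} (gs : Vec (PR n) m) (g : PR n) s →
            sizeAll gs + (size g + s) ≡ size g + sizeAll gs + s
sizeAll-∷ gs g s = trans (sym (+-assoc (sizeAll gs) (size g) s))
                         (cong (_+ s) (+-comm (sizeAll gs) (size g)))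

-- Correctness of the compiler.

module _ (Π : List Instr) where

  -- Continuation style: `G` is any property of states closed under stepping back, which avoids
  -- counting steps. `program-correct` takes for it the existence of a halting run.
  module Completeness (G : State → Set)
    (back : ∀ {a i} ρ → fetch Π a ≡ just i → G (exec i ρ) → G (a , ρ)) where

    complete    : ∀ {n} (e : PR n) {ins o b s x} → At Π s (compile e ins o b s x) → All (_< b) ins →
                  ∀ {ρ y} → Eval e (map ρ ins) y →
                  (∀ ρ′ → ρ′ o ≡ y → Frame b o ρ ρ′ → G (x , ρ′)) → G (s , ρ)
    completeAll : ∀ {n m} (gs : Vec (PR n) m) {ins o b c s} → At Π s (compileAll gs ins o b s) →
                  All (_< c) ins → c ≤ o → m + o ≤ b →
                  ∀ {ρ ys} → EvalAll gs (map ρ ins) ys →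
                  (∀ ρ′ → map ρ′ (interval o m) ≡ ys → Agree o ρ ρ′ → G (sizeAll gs + s , ρ′)) →
                  G (s , ρ)
    complete Z {o = o} (i , _) _ {ρ} ev-Z k =
      back ρ i (k _ (↦-same ρ o _) (Frame-↦ _ (λ _ _ → refl)))
    complete S {ins = _ ∷ []} {o = o} (i , _) _ {ρ} ev-S k =
      back ρ i (k _ (↦-same ρ o _) (Frame-↦ _ (λ _ _ → refl)))
    complete (Proj j) {ins} {o = o} (i , _) _ {ρ} ev-Proj k =
      back ρ i (k _ (trans (↦-same ρ o _) (sym (lookup-map j ρ ins))) (Frame-↦ _ (λ _ _ → refl)))
    complete (Comp {m = m} f gs) {ins} {o} {b} {s} {x} at a< {ρ} (ev-Comp evs ev) k
      with At-compileAll gs ins b (m + b) s at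
    ... | at₁ , at₂ =
      completeAll gs at₁ a< ≤-refl ≤-refl evs λ ρ₁ eq agr →
      complete f at₂ (interval-< b m) (subst (λ ys → Eval f ys _) (sym eq) ev) λ ρ₂ eq₂ fr →
      k ρ₂ eq₂ λ r r<b r≢o → trans (fr r (≤-trans r<b (m≤n+m b m)) r≢o) (agr r r<b)
    complete (Rec f g) {k ∷ ins} {o} {b} {s} {x} (i₁ , i₂ , at) (k< ∷ a<) {ρ} ev c
      with At-compile f ins _ _ _ _ at
    ... | atf , i₃ , at′ with At-compile g _ _ _ _ _ at′
    ... | atg , i₄ , i₅ , i₆ , _ =
      back ρ i₁ (back ρ₁ i₂ (main (ρ k) ev 0 (+-identityʳ _) λ ρ₃ agr _ r≡ c≡ →
        back ρ₃ i₃ (subst (λ v → G (decrement v _ _ b ρ₃)) (sym c≡)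
          (back ρ₃ i₆ (c _ (trans (↦-same ρ₃ o _) r≡) (Frame-↦ _ agr))))))
      where
      l = size f + (2 + s)
      xs = map ρ ins
      ρ₁ = ρ [ b ↦ ρ k ]
      ρ₂ = ρ₁ [ 1 + b ↦ 0 ]
      agr₂ : Agree b ρ ρ₂
      agr₂ = Agree-trans (Agree-↦ ρ _ ≤-refl) (Agree-↦ ρ₁ _ (n≤1+n b))
      -- Invariant at the loop head after `j` rounds: `1 + b` holds `j`, `2 + b` the value of the
      -- recursion at `j`, and `b` the `rest` rounds still to come.
      main : ∀ j {r} → Eval (Rec f g) (j ∷ xs) r → ∀ rest → j + rest ≡ ρ k →
             (∀ ρ′ → Agree b ρ ρ′ → ρ′ (1 + b) ≡ j → ρ′ (2 + b) ≡ r → ρ′ b ≡ rest → G (l , ρ′)) →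
             G (2 + s , ρ₂)
      main zero (ev-Rec0 ev) rest eq cont =
        complete f atf (All-≤ (m≤n+m b 4) a<)
          (subst (λ ys → Eval f ys _) (sym (map-Agree a< agr₂)) ev) λ ρ₃ r≡ fr →
        cont ρ₃ (Agree-trans agr₂ (Frame-Agree (m≤n+m b 4) (m≤n+m b 2) fr))
          (trans (fr (1 + b) (s≤s (m≤n+m (suc b) 2)) (<⇒≢ ≤-refl)) (↦-same ρ₁ (1 + b) 0)) r≡
          (trans (fr b (m≤n+m (suc b) 3) (<⇒≢ (m≤n+m (suc b) 1)))
            (trans (↦-other ρ₁ 0 (<⇒≢ ≤-refl)) (trans (↦-same ρ b _) (sym eq))))
      main (suc j) {r′} (ev-RecS {r = r} ev₁ ev₂) rest eq cont =
        main j ev₁ (suc rest) (trans (+-suc j rest) eq) λ ρ₃ agr₃ j≡ r≡ c≡ →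
        let ρ₄ = ρ₃ [ b ↦ rest ]
            agr₄ = Agree-trans agr₃ (Agree-↦ ρ₃ rest ≤-refl)
        in back ρ₃ i₃ (subst (λ v → G (decrement v _ _ b ρ₃)) (sym c≡)
          (complete g atg ((s≤s (m≤n+m (suc b) 2)) ∷ (s≤s (s≤s (m≤n+m (suc b) 1))) ∷ All-≤ (m≤n+m b 4) a<)
            {ρ₄} {r′}
            (subst (λ ys → Eval g ys r′)
              (cong₂ _∷_ (sym (trans (↦-other ρ₃ rest (>⇒≢ ≤-refl)) j≡))
                (cong₂ _∷_ (sym (trans (↦-other ρ₃ rest (>⇒≢ (m≤n+m (suc b) 1))) r≡))
                  (sym (map-Agree a< agr₄)))) ev₂) λ ρ₅ t≡ fr →
          let ρ₆ = ρ₅ [ 2 + b ↦ ρ₅ (3 + b) ]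
              ρ₇ = ρ₆ [ 1 + b ↦ suc (ρ₆ (1 + b)) ]
              agr₅ = Agree-trans agr₄ (Frame-Agree (m≤n+m b 4) (m≤n+m b 3) fr)
              agr₆ = Agree-trans agr₅ (Agree-↦ ρ₅ _ (m≤n+m b 2))
              agr₇ = Agree-trans agr₆ (Agree-↦ ρ₆ _ (m≤n+m b 1))
          in back ρ₅ i₄ (back ρ₆ i₅ (cont ρ₇ agr₇
            (trans (↦-same ρ₆ (1 + b) _) (cong suc
              (trans (↦-other ρ₅ _ (<⇒≢ ≤-refl))
              (trans (fr (1 + b) (s≤s (m≤n+m (suc b) 2)) (<⇒≢ (m≤n+m (2 + b) 1)))
              (trans (↦-other ρ₃ rest (>⇒≢ ≤-refl)) j≡)))))
            (trans (↦-other ρ₆ _ (>⇒≢ ≤-refl)) (trans (↦-same ρ₅ (2 + b) _) t≡))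
            (trans (↦-other ρ₆ _ (<⇒≢ ≤-refl))
              (trans (↦-other ρ₅ _ (<⇒≢ (m≤n+m (suc b) 1)))
              (trans (fr b (m≤n+m (suc b) 3) (<⇒≢ (m≤n+m (suc b) 2))) (↦-same ρ₃ b rest))))))))
    complete (Mu f) {ins} {o} {b} {s} {x} (i₁ , at) a< {ρ} (ev-Mu {y = y} ev evs) k
      with At-compile f (b ∷ ins) _ _ _ _ at
    ... | atf , i₂ , i₃ , i₄ , _ = back ρ i₁ (main y 0 (+-identityʳ y) (Agree-↦ ρ 0 ≤-refl) (↦-same ρ b 0))
      where
      l = size f + (1 + s)
      inputs : ∀ {z ρ′} → Agree b ρ ρ′ → ρ′ b ≡ z → z ∷ map ρ ins ≡ map ρ′ (b ∷ ins)
      inputs agr z≡ = cong₂ _∷_ (sym z≡) (sym (map-Agree a< agr))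
      -- `d` is the distance from the candidate `z` to the least zero `y`.
      main : ∀ d z → d + z ≡ y → ∀ {ρ′} → Agree b ρ ρ′ → ρ′ b ≡ z → G (1 + s , ρ′)
      main zero z refl {ρ′} agr z≡ =
        complete f atf (≤-trans (n<1+n b) (n≤1+n _) ∷ All-≤ (m≤n+m b 2) a<)
          (subst (λ ys → Eval f ys 0) (inputs agr z≡) ev) λ ρ₁ v≡ fr →
        back ρ₁ i₂ (subst (λ v → G (decrement v _ _ (1 + b) ρ₁)) (sym v≡)
          (back ρ₁ i₄ (k _ (trans (↦-same ρ₁ o _)
                             (trans (fr b (m≤n+m (suc b) 1) (<⇒≢ ≤-refl)) z≡))
            (Frame-↦ _ (Agree-trans agr (Frame-Agree (m≤n+m b 2) (n≤1+n b) fr))))))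
      main (suc d) z refl {ρ′} agr z≡ with evs z (s≤s (m≤n+m z d))
      ... | m , ev′ =
        complete f atf (≤-trans (n<1+n b) (n≤1+n _) ∷ All-≤ (m≤n+m b 2) a<)
          (subst (λ ys → Eval f ys (suc m)) (inputs agr z≡) ev′) λ ρ₁ v≡ fr →
        let ρ₂ = ρ₁ [ 1 + b ↦ m ]
            agr₂ = Agree-trans (Agree-trans agr (Frame-Agree (m≤n+m b 2) (n≤1+n b) fr))
                               (Agree-↦ ρ₁ m (n≤1+n b))
        in back ρ₁ i₂ (subst (λ v → G (decrement v _ _ (1 + b) ρ₁)) (sym v≡)
          (back ρ₂ i₃ (main d (suc z) (+-suc d z) (Agree-trans agr₂ (Agree-↦ ρ₂ _ ≤-refl))
            (trans (↦-same ρ₂ b _) (cong suc (trans (↦-other ρ₁ m (<⇒≢ ≤-refl))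
              (trans (fr b (m≤n+m (suc b) 1) (<⇒≢ ≤-refl)) z≡)))))))
    completeAll [] _ _ _ _ {ρ} [] k = k ρ refl (λ _ _ → refl)
    completeAll {m = suc m} (g ∷ gs) {ins} {o} {b} {c} {s} at a< c≤o o≤b {ρ} (_∷_ {y = y} ev evs) k
      with At-compile g ins _ _ _ _ at
    ... | at₁ , at₂ =
      complete g at₁ (All-≤ c≤b a<) ev λ ρ₁ y≡ fr →
      completeAll gs at₂ a< (≤-trans c≤o (n≤1+n o)) (≤-trans (≤-reflexive (+-suc m o)) o≤b)
        (subst (λ ys → EvalAll gs ys _) (sym (map-Agree a< (Frame-Agree c≤b c≤o fr))) evs) λ ρ₂ ys≡ agr →
      subst (λ t → G (t , ρ₂)) (sym (sizeAll-∷ gs g s)) (k ρ₂ (cong₂ _∷_ (trans (agr o ≤-refl) y≡) ys≡)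
        λ r r<o → trans (agr r (≤-trans r<o (n≤1+n o))) (Frame-Agree o≤b′ ≤-refl fr r r<o))
      where
      o≤b′ : o ≤ b
      o≤b′ = ≤-trans (m≤n+m o (suc m)) o≤b
      c≤b : c ≤ b
      c≤b = ≤-trans c≤o o≤b′

  module Soundness where

    HI : ℕ → State → Set
    HI = HaltsIn Π

    advance : ∀ {a i ρ} N → fetch Π a ≡ just i → HI N (a , ρ) → ∃[ N′ ] N′ < N × HI N′ (exec i ρ)
    advance zero eq refl with trans (sym eq) (fetch-length Π)
    ... | ()
    advance {a} {i} {ρ} (suc N) eq h =
      N , ≤-refl , subst (λ c → HI N (maybe′ (λ i → exec i ρ) (a , ρ) c)) eq h

    -- The evaluation is extracted from the halting run itself. The strict decrease `N′ < N` lets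
    -- the unbounded search of `Mu` recurse on the steps left.
    Outcome : ∀ {n} → PR n → Vec ℕ n → (o b x : ℕ) → Registers → ℕ → Set
    Outcome e ins o b x ρ N = ∃[ ρ′ ] ∃[ N′ ]
      Eval e (map ρ ins) (ρ′ o) × Frame b o ρ ρ′ × N′ < N × HI N′ (x , ρ′)

    sound    : ∀ {n} (e : PR n) {ins o b s x} → At Π s (compile e ins o b s x) → All (_< b) ins →
               ∀ {ρ} N → HI N (s , ρ) → Outcome e ins o b x ρ N
    soundAll : ∀ {n m} (gs : Vec (PR n) m) {ins o b c s} → At Π s (compileAll gs ins o b s) →
               All (_< c) ins → c ≤ o → m + o ≤ b →
               ∀ {ρ} N → HI N (s , ρ) →
               ∃[ ρ′ ] ∃[ N′ ] EvalAll gs (map ρ ins) (map ρ′ (interval o m)) × Agree o ρ ρ′ ×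
               N′ ≤ N × HI N′ (sizeAll gs + s , ρ′)
    sound Z {o = o} (i , _) _ {ρ} N h with advance N i h
    ... | N′ , N′<N , h′ = _ , N′ , subst (Eval Z _) (sym (↦-same ρ o _)) ev-Z ,
                           Frame-↦ _ (λ _ _ → refl) , N′<N , h′
    sound S {ins = _ ∷ []} {o = o} (i , _) _ {ρ} N h with advance N i h
    ... | N′ , N′<N , h′ = _ , N′ , subst (Eval S _) (sym (↦-same ρ o _)) ev-S ,
                           Frame-↦ _ (λ _ _ → refl) , N′<N , h′
    sound (Proj j) {ins} {o = o} (i , _) _ {ρ} N h with advance N i h
    ... | N′ , N′<N , h′ = _ , N′ ,
                           subst (Eval (Proj j) _) (trans (lookup-map j ρ ins) (sym (↦-same ρ o _))) ev-Proj ,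
                           Frame-↦ _ (λ _ _ → refl) , N′<N , h′
    sound (Comp {m = m} f gs) {ins} {o} {b} {s} {x} at a< {ρ} N h
      with At-compileAll gs ins b (m + b) s at
    ... | at₁ , at₂ with soundAll gs at₁ a< ≤-refl ≤-refl N h
    ... | ρ₁ , N₁ , evs , agr , N₁≤N , h₁ with sound f at₂ (interval-< b m) N₁ h₁
    ... | ρ₂ , N₂ , ev , fr , N₂<N₁ , h₂ =
      ρ₂ , N₂ , ev-Comp evs ev ,
      (λ r r<b r≢o → trans (fr r (≤-trans r<b (m≤n+m b m)) r≢o) (agr r r<b)) ,
      ≤-trans N₂<N₁ N₁≤N , h₂
    sound (Rec f g) {k ∷ ins} {o} {b} {s} {x} (i₁ , i₂ , at) (k< ∷ a<) {ρ} N h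
      with At-compile f ins _ _ _ _ at
    ... | atf , i₃ , at′ with At-compile g _ _ _ _ _ at′
    ... | atg , i₄ , i₅ , i₆ , _ with advance N i₁ h
    ... | N₁ , N₁<N , h₁ with advance N₁ i₂ h₁
    ... | N₂ , N₂<N₁ , h₂ with sound f atf (All-≤ (m≤n+m b 4) a<) N₂ h₂
    ... | ρ₃ , N₃ , ev , fr , N₃<N₂ , h₃ =
      main (ρ k) 0 refl
        (Agree-trans agr₂ (Frame-Agree (m≤n+m b 4) (m≤n+m b 2) fr))
        (trans (fr (1 + b) (s≤s (m≤n+m (suc b) 2)) (<⇒≢ ≤-refl)) (↦-same ρ₁ (1 + b) 0))
        (trans (fr b (m≤n+m (suc b) 3) (<⇒≢ (m≤n+m (suc b) 1)))
            (trans (↦-other ρ₁ 0 (<⇒≢ ≤-refl)) (↦-same ρ b _)))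
        (ev-Rec0 (subst (λ ys → Eval f ys _) (map-Agree a< agr₂) ev))
        N₃ (<-trans N₃<N₂ (<-trans N₂<N₁ N₁<N)) h₃
      where
      l = size f + (2 + s)
      xs = map ρ ins
      ρ₁ = ρ [ b ↦ ρ k ]
      ρ₂ = ρ₁ [ 1 + b ↦ 0 ]
      agr₂ : Agree b ρ ρ₂
      agr₂ = Agree-trans (Agree-↦ ρ _ ≤-refl) (Agree-↦ ρ₁ _ (n≤1+n b))
      -- The invariant is that of `complete`; the recursion is on the countdown register.
      main : ∀ rest j → j + rest ≡ ρ k → ∀ {ρ₃} → Agree b ρ ρ₃ → ρ₃ (1 + b) ≡ j → ρ₃ b ≡ rest →
             Eval (Rec f g) (j ∷ xs) (ρ₃ (2 + b)) → ∀ M → M < N → HI M (l , ρ₃) →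
             Outcome (Rec f g) (k ∷ ins) o b x ρ N
      main zero j eq {ρ₃} agr₃ j≡ c≡ ev M M<N h with advance M i₃ h
      ... | M₁ , M₁<M , h₁ rewrite c≡ with advance M₁ i₆ h₁
      ... | M₂ , M₂<M₁ , h₂ =
        _ , M₂ , subst₂ (λ i r → Eval (Rec f g) (i ∷ xs) r) (trans (sym (+-identityʳ j)) eq)
                   (sym (↦-same ρ₃ o _)) ev ,
        Frame-↦ _ agr₃ , <-trans M₂<M₁ (<-trans M₁<M M<N) , h₂
      main (suc rest) j eq {ρ₃} agr₃ j≡ c≡ ev M M<N h with advance M i₃ h
      ... | M₁ , M₁<M , h₁ rewrite c≡
        with sound g atg ((s≤s (m≤n+m (suc b) 2)) ∷ (s≤s (s≤s (m≤n+m (suc b) 1))) ∷ All-≤ (m≤n+m b 4) a<) M₁ h₁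
      ... | ρ₅ , M₂ , ev₅ , fr , M₂<M₁ , h₂ with advance M₂ i₄ h₂
      ... | M₃ , M₃<M₂ , h₃ with advance M₃ i₅ h₃
      ... | M₄ , M₄<M₃ , h₄ =
        main rest (suc j) (trans (sym (+-suc j rest)) eq) agr₇
          (trans (↦-same ρ₆ (1 + b) _) (cong suc
              (trans (↦-other ρ₅ _ (<⇒≢ ≤-refl))
              (trans (fr (1 + b) (s≤s (m≤n+m (suc b) 2)) (<⇒≢ (m≤n+m (2 + b) 1)))
              (trans (↦-other ρ₃ rest (>⇒≢ ≤-refl)) j≡)))))
          (trans (↦-other ρ₆ _ (<⇒≢ ≤-refl))
              (trans (↦-other ρ₅ _ (<⇒≢ (m≤n+m (suc b) 1)))
              (trans (fr b (m≤n+m (suc b) 3) (<⇒≢ (m≤n+m (suc b) 2))) (↦-same ρ₃ b rest))))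
          (ev-RecS ev (subst₂ (Eval g)
            (cong₂ _∷_ (trans (↦-other ρ₃ rest (>⇒≢ ≤-refl)) j≡)
                (cong₂ _∷_ (↦-other ρ₃ rest (>⇒≢ (m≤n+m (suc b) 1))) (map-Agree a< agr₄)))
            (sym (trans (↦-other ρ₆ _ (>⇒≢ ≤-refl)) (↦-same ρ₅ (2 + b) _))) ev₅))
          M₄ (<-trans M₄<M₃ (<-trans M₃<M₂ (<-trans M₂<M₁ (<-trans M₁<M M<N)))) h₄
        where
        ρ₄ = ρ₃ [ b ↦ rest ]
        agr₄ = Agree-trans agr₃ (Agree-↦ ρ₃ rest ≤-refl)
        ρ₆ = ρ₅ [ 2 + b ↦ ρ₅ (3 + b) ]
        ρ₇ = ρ₆ [ 1 + b ↦ suc (ρ₆ (1 + b)) ]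
        agr₇ = Agree-trans (Agree-trans (Agree-trans agr₄ (Frame-Agree (m≤n+m b 4) (m≤n+m b 3) fr))
                 (Agree-↦ ρ₅ _ (m≤n+m b 2))) (Agree-↦ ρ₆ _ (m≤n+m b 1))
    sound (Mu f) {ins} {o} {b} {s} {x} (i₁ , at) a< {ρ} N h
      with At-compile f (b ∷ ins) _ _ _ _ at
    ... | atf , i₂ , i₃ , i₄ , _ with advance N i₁ h
    ... | N₁ , N₁<N , h₁ =
      main 0 (λ _ ()) (Agree-↦ ρ 0 ≤-refl) (↦-same ρ b 0) N₁ (<-wellFounded N₁) N₁<N h₁
      where
      l = size f + (1 + s)
      inputs : ∀ {z ρ′} → Agree b ρ ρ′ → ρ′ b ≡ z → map ρ′ (b ∷ ins) ≡ z ∷ map ρ ins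
      inputs agr z≡ = cong₂ _∷_ z≡ (map-Agree a< agr)
      -- The positive values found at the candidates below `z` are kept, since `ev-Mu` asks for them
      -- in the end.
      main : ∀ z → (∀ i → i < z → ∃[ m ] Eval f (i ∷ map ρ ins) (suc m)) →
             ∀ {ρ′} → Agree b ρ ρ′ → ρ′ b ≡ z → ∀ M → Acc _<_ M → M < N → HI M (1 + s , ρ′) →
             Outcome (Mu f) ins o b x ρ N
      main z evs {ρ′} agr z≡ M (acc rs) M<N h
        with sound f atf (≤-trans (n<1+n b) (n≤1+n _) ∷ All-≤ (m≤n+m b 2) a<) M h
      ... | ρ₁ , M₁ , ev , fr , M₁<M , h₁ with advance M₁ i₂ h₁
      ... | M₂ , M₂<M₁ , h₂ with ρ₁ (1 + b) in v≡
      main z evs {ρ′} agr z≡ M (acc rs) M<N h | ρ₁ , M₁ , ev , fr , M₁<M , h₁ | M₂ , M₂<M₁ , h₂ | zero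
        with advance M₂ i₄ h₂
      ... | M₃ , M₃<M₂ , h₃ =
        _ , M₃ , subst (Eval (Mu f) _)
                   (sym (trans (↦-same ρ₁ o _) (trans (fr b (m≤n+m (suc b) 1) (<⇒≢ ≤-refl)) z≡)))
                   (ev-Mu (subst (λ ys → Eval f ys 0) (inputs agr z≡) ev) evs) ,
        Frame-↦ _ (Agree-trans agr (Frame-Agree (m≤n+m b 2) (n≤1+n b) fr)) ,
        <-trans M₃<M₂ (<-trans M₂<M₁ (<-trans M₁<M M<N)) , h₃
      main z evs {ρ′} agr z≡ M (acc rs) M<N h | ρ₁ , M₁ , ev , fr , M₁<M , h₁ | M₂ , M₂<M₁ , h₂ | suc m
        with advance M₂ i₃ h₂
      ... | M₃ , M₃<M₂ , h₃ =
        main (suc z) evs′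
          (Agree-trans (Agree-trans (Agree-trans agr (Frame-Agree (m≤n+m b 2) (n≤1+n b) fr))
                               (Agree-↦ ρ₁ m (n≤1+n b))) (Agree-↦ ρ₂ _ ≤-refl))
          (trans (↦-same ρ₂ b _) (cong suc (trans (↦-other ρ₁ m (<⇒≢ ≤-refl))
              (trans (fr b (m≤n+m (suc b) 1) (<⇒≢ ≤-refl)) z≡))))
          M₃ (rs M₃<M) (<-trans M₃<M M<N) h₃
        where
        ρ₂ = ρ₁ [ 1 + b ↦ m ]
        M₃<M = <-trans M₃<M₂ (<-trans M₂<M₁ M₁<M)
        evs′ : ∀ i → i < suc z → ∃[ m ] Eval f (i ∷ map ρ ins) (suc m)
        evs′ i i<sz with m≤n⇒m<n∨m≡n (≤-pred i<sz)
        ... | inj₁ i<z  = evs i i<z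
        ... | inj₂ refl = m , subst (λ ys → Eval f ys (suc m)) (inputs agr z≡) ev
    soundAll [] _ _ _ _ {ρ} N h = ρ , N , [] , (λ _ _ → refl) , ≤-refl , h
    soundAll {m = suc m} (g ∷ gs) {ins} {o} {b} {c} {s} at a< c≤o o≤b {ρ} N h
      with At-compile g ins _ _ _ _ at
    ... | at₁ , at₂ with sound g at₁ (All-≤ (≤-trans c≤o (≤-trans (m≤n+m o (suc m)) o≤b)) a<) N h
    ... | ρ₁ , N₁ , ev , fr , N₁<N , h₁
      with soundAll gs at₂ a< (≤-trans c≤o (n≤1+n o)) (≤-trans (≤-reflexive (+-suc m o)) o≤b) N₁ h₁
    ... | ρ₂ , N₂ , evs , agr , N₂≤N₁ , h₂ =
      ρ₂ , N₂ ,
      (subst (Eval g _) (sym (agr o ≤-refl)) ev ∷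
       subst (λ ys → EvalAll gs ys _) (map-Agree a< (Frame-Agree (≤-trans c≤o o≤b′) c≤o fr)) evs) ,
      (λ r r<o → trans (agr r (≤-trans r<o (n≤1+n o))) (Frame-Agree o≤b′ ≤-refl fr r r<o)) ,
      ≤-trans N₂≤N₁ (<⇒≤ N₁<N) , subst (λ t → HI N₂ (t , ρ₂)) (sizeAll-∷ gs g s) h₂
      where
      o≤b′ : o ≤ b
      o≤b′ = ≤-trans (m≤n+m o (suc m)) o≤b

program : PR 1 → List Instr
program e = compile e (0 ∷ []) 1 2 0 (size e)

initial : ℕ → State
initial n = 0 , (λ _ → 0) [ 0 ↦ n ]

program-correct : ∀ e n → (∃ λ y → Eval e (n ∷ []) y) → ∃[ N ] HaltsIn (program e) N (initial n)
program-correct e n (y , ev) =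
  complete e (At-self Π) (s≤s z≤n ∷ []) ev λ _ _ _ → 0 , sym (length-compile e _ _ _ _ _)
  where
  Π = program e
  open Completeness Π (λ c → ∃[ N ] HaltsIn Π N c)
    (λ {a} {i} ρ eq (N , h) → suc N , subst (λ c → HaltsIn Π N (maybe′ (λ i → exec i ρ) (a , ρ) c)) (sym eq) h)

program-correct⁻¹ : ∀ e n → ∃[ N ] HaltsIn (program e) N (initial n) → ∃ λ y → Eval e (n ∷ []) y
program-correct⁻¹ e n (N , h) with Soundness.sound (program e) e (At-self (program e)) (s≤s z≤n ∷ []) N h
... | _ , _ , ev , _ = _ , ev

-- The formulas

P : ℕ → Form
P x = atom 1 0 (x ∷ [])

p : Form
p = atom 0 0 []

F : Form
F = □ p

infix 8 ~_
~_ : Form → Form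
~ φ = φ ⇒ F

-- On cells, comparing values: geq a b means a ≥ b, less a b means a < b, cover a b means b ≤ a + 1, and
-- last a b, at a downset containing a, that a is maximal in it.
geq last less cover : ℕ → ℕ → Form
geq a b   = □ (P a ⇒ p ⇒ ~ (P b) ⇒ F)
last a b  = ∀' b (P b ⇒ geq a b)
less a b  = □ (P b ⇒ p ⇒ last a b ⇒ F)
cover a b = □ (P a ⇒ p ⇒ ~ last a b ⇒ ~ P b ⇒ F)

-- Subscripts name the free variable.
zero₀ : Form
zero₀ = □ (p ⇒ ~ P 0 ⇒ F)

-- `~ ∀' x (... ⇒ F)` is the existential quantifier relative to `F`. Passing to a cell of equal
-- value transports `φ` from variable 0 to variable 1, so that `value₀` iterates one operation, as
-- `forms-iterate` requires.
value₁∘ : Form → Form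
value₁∘ φ = ~ ∀' 0 (geq 1 0 ⇒ geq 0 1 ⇒ φ ⇒ F)

value-suc : Form → Form
value-suc φ = ~ ∀' 1 (geq 0 1 ⇒ less 1 0 ⇒ cover 1 0 ⇒ value₁∘ φ ⇒ F)

value₀ value₁ : ℕ → Form
value₀ zero    = zero₀
value₀ (suc m) = value-suc (value₀ m)
value₁ m       = value₁∘ (value₀ m)

-- Among the sets not marked by p, row i is the only one to contain a cell of value i, because
-- configurations store a register value v as the cell of value K + v with K > i.
row₀ row₁ : ℕ → Form
row₀ i = □ (∀' 1 (P 1 ⇒ value₁ i ⇒ ~ p ⇒ ~ P 0 ⇒ F))
row₁ i = □ (∀' 0 (P 0 ⇒ value₀ i ⇒ ~ p ⇒ ~ P 1 ⇒ F))

data Update : Set where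
  const      : ℕ → Update
  keep up dn : ℕ → Update

-- Register 0 of the formulas is the program counter.
values : State → ℕ → ℕ
values (a , ρ) zero    = a
values (a , ρ) (suc r) = ρ r

update : Update → (ℕ → ℕ) → ℕ
update (const m) v = m
update (keep i)  v = v i
update (up i)    v = suc (v i)
update (dn i)    v = pred (v i)

fromSource : Source → Update
fromSource zeroS    = const 0
fromSource (copy i) = keep (suc i)
fromSource (incr i) = up (suc i)

setU : ℕ → Source → ℕ → ℕ → Update
setU j s a zero    = const a
setU j s a (suc r) = if does (r ≟ j) then fromSource s else keep (suc r)

zeroU : ℕ → ℕ → Update
zeroU a zero    = const a
zeroU a (suc r) = keep (suc r)

decU : ℕ → ℕ → ℕ → Update
decU i b zero    = const b
decU i b (suc r) = if does (r ≟ i) then dn (suc i) else keep (suc r)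

module Formulas (K : ℕ) where

  register : ℕ → Form → Form
  register j φ = ~ ∀' 0 (φ ⇒ row₀ j ⇒ P 0 ⇒ F)

  -- Variable 1 names the next configuration.
  transfer : ℕ → Update → Form
  transfer j (const m) = □ (P 1 ⇒ register j (value₀ (K + m)))
  -- The name has done its work once the guard `P 1` has selected the next world, so variable 1 can
  -- be bound anew, to the copy; variable 0 carries the old cell along.
  transfer j (keep i)  =
    ∀' 0 (P 0 ⇒ row₀ i ⇒ □ (P 1 ⇒ ~ ∀' 1 (geq 0 1 ⇒ geq 1 0 ⇒ row₁ j ⇒ P 1 ⇒ F)))
  transfer j (up i)    =
    ∀' 0 (P 0 ⇒ row₀ i ⇒ □ (P 1 ⇒ ~ ∀' 1 (geq 1 0 ⇒ less 0 1 ⇒ cover 0 1 ⇒ row₁ j ⇒ P 1 ⇒ F)))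
  -- Variable 1 becomes the predecessor of the old cell, which frees variable 0 for the new one.
  transfer j (dn i)    =
    ∀' 0 (P 0 ⇒ row₀ i ⇒ □ (P 1 ⇒ ∀' 1 (geq 0 1 ⇒ less 1 0 ⇒ cover 1 0 ⇒
      ~ ∀' 0 (geq 1 0 ⇒ geq 0 1 ⇒ row₀ j ⇒ P 0 ⇒ F))))

  -- A conjunction negated relative to `F`, by currying; `successor` negates it once more.
  transfers : ℕ → (ℕ → Update) → Form
  transfers zero    u = F
  transfers (suc k) u = transfer k (u k) ⇒ transfers k u

  -- Some name occurs at an accessible world, occurs at no accessible world satisfying `p`, and
  -- obeys the transfers: every accessible world holding it is the next configuration.
  successor : (ℕ → Update) → Form
  successor u = ~ ∀' 1 (~ □ (P 1 ⇒ F) ⇒ □ (P 1 ⇒ p ⇒ F) ⇒ transfers K u)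

  -- Downsets satisfy p, and no row has cells of both registers 0 and 1: only configurations meet the premises.
  at : ℕ → Form → Form
  at ℓ φ = □ (~ p ⇒ ∀' 0 (P 0 ⇒ row₀ 1 ⇒ ∀' 0 (P 0 ⇒ row₀ 0 ⇒ value₀ (K + ℓ) ⇒ φ)))

  positive : Form
  positive = ~ ∀' 1 (value₁ K ⇒ less 1 0 ⇒ F)

  ifZero ifPositive : ℕ → Form → Form
  ifZero i φ     = ∀' 0 (P 0 ⇒ row₀ (suc i) ⇒ value₀ K ⇒ φ)
  ifPositive i φ = ∀' 0 (P 0 ⇒ row₀ (suc i) ⇒ positive ⇒ φ)

  axioms : ℕ → List Instr → Form → Form
  axioms ℓ []                φ = φ
  axioms ℓ (set j s a ∷ Π)   φ = at ℓ (successor (setU j s a)) ⇒ axioms (suc ℓ) Π φ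
  axioms ℓ (djz i a b ∷ Π)   φ = at ℓ (ifZero i (successor (zeroU a))) ⇒
                                 at ℓ (ifPositive i (successor (decU i b))) ⇒ axioms (suc ℓ) Π φ

  -- The parameter φ describes the contents of register 1, which holds the input.
  content : ℕ → Form → Form
  content 1 φ = φ
  content _ φ = value₀ (K + 0)

  content-initial : ∀ j n → content j (value₀ (K + n)) ≡ value₀ (K + values (initial n) j)
  content-initial 0             n = refl
  content-initial 1             n = refl
  content-initial (suc (suc j)) n = refl

  registers : ℕ → Form → Form
  registers zero    φ = F
  registers (suc j) φ = register j (content j φ) ⇒ registers j φ

  start : Form → Form
  start φ = ~ □ (~ p ⇒ registers K φ)

  -- Rather than asserting that a halted configuration exists, the first premise lets one imply `F`,
  -- the conclusion.
  halting : List Instr → Form → Form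
  halting Π φ = at (length Π) F ⇒ axioms 0 Π (start φ ⇒ F)

-- Semantic counterparts of the formulas.

module Semantics {W : Set} {R : Rel W Level.zero} {𝓕 : PFrame W R} (𝓜 : Model 𝓕) where
  open PFrame 𝓕
  open Model 𝓜

  Pᴹ : W → U → Set
  Pᴹ w d = I w 1 0 (d ∷ [])

  pᴹ : W → Set
  pᴹ w = I w 0 0 []

  Fᴹ : W → Set
  Fᴹ w = ∀ v → R w v → pᴹ v

  Zero : W → U → Set
  Zero w d = ∀ v → R w v → pᴹ v → (Pᴹ v d → Fᴹ v) → Fᴹ v

  Geq Less Cover : W → U → U → Set
  Last : W → U → Set
  Geq w d e = ∀ v → R w v → Pᴹ v d → pᴹ v → (Pᴹ v e → Fᴹ v) → Fᴹ v
  Last w d = ∀ e → D w e → Pᴹ w e → Geq w d e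
  Less w d e = ∀ v → R w v → Pᴹ v e → pᴹ v → Last v d → Fᴹ v
  Cover w d e = ∀ v → R w v → Pᴹ v d → pᴹ v → (Last v d → Fᴹ v) → (Pᴹ v e → Fᴹ v) → Fᴹ v

  -- The existential is a genuine one, whereas that of `value₀` is relative to `F`. Hence the
  -- elimination lemmas apply only when `F` is to be proved.
  Value : ℕ → W → U → Set
  Value zero    w d = Zero w d
  Value (suc m) w d = ∃[ e ] D w e × Geq w d e × Less w e d × Cover w e d × Value m w e

  Row : ℕ → W → U → Set
  Row i w d = ∀ v → R w v → ∀ e → D v e → Pᴹ v e → Value i v e → (pᴹ v → Fᴹ v) → (Pᴹ v d → Fᴹ v) → Fᴹ v

  geq-refl : ∀ w d → Geq w d d
  geq-refl w d v _ Pd _ k = k Pd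

  geq-trans : ∀ {w d e f} → Geq w d e → Geq w e f → Geq w d f
  geq-trans de ef v r Pd pv k = de v r Pd pv λ Pe → ef v r Pe pv k

  -- Undoes the passage to a cell of equal value in `value₁∘` and in the transfers.
  value-resp : ∀ m {w d e} → Geq w d e → Geq w e d → Value m w d → Value m w e
  value-resp zero    de ed z v r pv k = z v r pv λ Pd → de v r Pd pv k
  value-resp (suc m) de ed (f , Df , df , fd , cov , val) =
    f , Df , geq-trans ed df ,
    (λ v r Pe pv l → ed v r Pe pv λ Pd → fd v r Pd pv l) ,
    (λ v r Pf pv l k → cov v r Pf pv l λ Pd → de v r Pd pv k) , val

  value₁∘-intro : ∀ φ w g → D w (g 1) → Sat 𝓜 w (_[_≔_] 𝓜 g 0 (g 1)) φ → Sat 𝓜 w g (value₁∘ φ)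
  value₁∘-intro φ w g Dd h k = k (g 1) Dd (geq-refl w (g 1)) (geq-refl w (g 1)) h

  value₀-intro : ∀ m w g → D w (g 0) → Value m w (g 0) → Sat 𝓜 w g (value₀ m)
  value₀-intro zero    w g Dd z = z
  value₀-intro (suc m) w g Dd (e , De , s₁ , s₂ , s₃ , val) k =
    k e De s₁ s₂ s₃ (value₁∘-intro (value₀ m) w _ De (value₀-intro m w _ De val))

  value₁-intro : ∀ m w g → D w (g 1) → Value m w (g 1) → Sat 𝓜 w g (value₁ m)
  value₁-intro m w g Dd val =
    value₁∘-intro (value₀ m) w g Dd (value₀-intro m w _ Dd val)

  value₀-elim : ∀ m w g → Sat 𝓜 w g (value₀ m) → (Value m w (g 0) → Fᴹ w) → Fᴹ w
  value₀-elim zero    w g z k = k z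
  value₀-elim (suc m) w g h k = h λ e De s₁ s₂ s₃ h′ → h′ λ d Dd ed de h″ →
    value₀-elim m w _ h″ λ val → k (e , De , s₁ , s₂ , s₃ , value-resp m de ed val)

  value₁-elim : ∀ m w g → Sat 𝓜 w g (value₁ m) → (Value m w (g 1) → Fᴹ w) → Fᴹ w
  value₁-elim m w g h k = h λ d Dd ed de h′ → value₀-elim m w _ h′ λ val → k (value-resp m de ed val)

  row₀-intro : ∀ i w g → Row i w (g 0) → Sat 𝓜 w g (row₀ i)
  row₀-intro i w g row v r e De Pe h np k = value₁-elim i v _ h λ val → row v r e De Pe val np k

  row₁-intro : ∀ i w g → Row i w (g 1) → Sat 𝓜 w g (row₁ i)
  row₁-intro i w g row v r e De Pe h np k = value₀-elim i v _ h λ val → row v r e De Pe val np k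

  row₀-elim : ∀ i w g → Sat 𝓜 w g (row₀ i) → Row i w (g 0)
  row₀-elim i w g h v r e De Pe val np k = h v r e De Pe (value₁-intro i v _ De val) np k

  row₁-elim : ∀ i w g → Sat 𝓜 w g (row₁ i) → Row i w (g 1)
  row₁-elim i w g h v r e De Pe val np k = h v r e De Pe (value₀-intro i v _ De val) np k

-- The registers to be described, and instructions as updates.

sourceBound : Source → ℕ
sourceBound zeroS    = 0
sourceBound (copy i) = 2 + i
sourceBound (incr i) = 2 + i

-- Only registers that are read count; one that is only written may be missing from the
-- configurations. Machine register `i` is register `suc i` of the formulas, and `2 + i` puts that
-- one below the bound.
instrBound : Instr → ℕ
instrBound (set _ s _) = sourceBound s
instrBound (djz i _ _) = 2 + i

registerBound : List Instr → ℕ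
-- `at` refers to the rows 0 and 1.
registerBound []      = 2
registerBound (i ∷ Π) = instrBound i + registerBound Π

2≤registerBound : ∀ Π → 2 ≤ registerBound Π
2≤registerBound []      = ≤-refl
2≤registerBound (i ∷ Π) = ≤-trans (2≤registerBound Π) (m≤n+m _ (instrBound i))

instrBound≤ : ∀ Π a {i} → fetch Π a ≡ just i → instrBound i ≤ registerBound Π
instrBound≤ (i ∷ Π) zero    refl = m≤m+n _ _
instrBound≤ (i ∷ Π) (suc a) eq   = ≤-trans (instrBound≤ Π a eq) (m≤n+m _ (instrBound i))

Bounded : ℕ → Update → Set
Bounded K (const m) = ⊤
Bounded K (keep i)  = i < K
Bounded K (up i)    = i < K
Bounded K (dn i)    = i < K

-- At content 0, `pred` and the formula part ways: `transfer j (dn i)` would ask for a cell of value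
-- `K - 1`.
Enabled : Update → (ℕ → ℕ) → Set
Enabled (dn i) v = 0 < v i
Enabled _      v = ⊤

Applies : ℕ → (ℕ → Update) → State → State → Set
Applies K u c c′ = ∀ r → r < K →
  Bounded K (u r) × Enabled (u r) (values c) × update (u r) (values c) ≡ values c′ r

module _ {K : ℕ} where

  setU-applies : ∀ ℓ j s a ρ → sourceBound s ≤ K → Applies K (setU j s a) (ℓ , ρ) (exec (set j s a) ρ)
  setU-applies ℓ j s a ρ b zero    r<K = tt , tt , refl
  setU-applies ℓ j s a ρ b (suc r) r<K with does (r ≟ j)
  setU-applies ℓ j zeroS    a ρ b (suc r) r<K | true = tt , tt , refl
  setU-applies ℓ j (copy i) a ρ b (suc r) r<K | true = b , tt , refl
  setU-applies ℓ j (incr i) a ρ b (suc r) r<K | true = b , tt , refl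
  ... | false = r<K , tt , refl

  zeroU-applies : ∀ ℓ a ρ → Applies K (zeroU a) (ℓ , ρ) (a , ρ)
  zeroU-applies ℓ a ρ zero    r<K = tt , tt , refl
  zeroU-applies ℓ a ρ (suc r) r<K = r<K , tt , refl

  decU-applies : ∀ ℓ i b ρ {v} → 2 + i ≤ K → ρ i ≡ suc v →
                 Applies K (decU i b) (ℓ , ρ) (b , ρ [ i ↦ v ])
  decU-applies ℓ i b ρ i<K eq zero    r<K = tt , tt , refl
  decU-applies ℓ i b ρ i<K eq (suc r) r<K with does (r ≟ i)
  ... | true  = i<K , subst (0 <_) (sym eq) (s≤s z≤n) , cong pred eq
  ... | false = r<K , tt , refl

<-extend : ∀ {A : ℕ → Set} {k} → (∀ j → j < k → A j) → A k → ∀ j → j < suc k → A j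
<-extend as a j j<sk with m≤n⇒m<n∨m≡n (≤-pred j<sk)
... | inj₁ j<k  = as j j<k
... | inj₂ refl = a

-- Double negation relative to `X` commutes with finite conjunctions.
collect : ∀ {A : ℕ → Set} {X : Set} k → (∀ j → j < k → (A j → X) → X) → ((∀ j → j < k → A j) → X) → X
collect zero    h c = c λ _ ()
collect (suc k) h c = collect k (λ j j<k → h j (≤-trans j<k (n≤1+n k))) λ as →
                      h k ≤-refl λ a → c (<-extend as a)

-- Using the axioms in an arbitrary model on a transitive frame.

module Derivation {W : Set} {R : Rel W Level.zero} (R-trans : ∀ {u v w} → R u v → R v w → R u w)
                  {𝓕 : PFrame W R} (𝓜 : Model 𝓕) where
  open PFrame 𝓕
  open Semantics 𝓜

  Zero-mono : ∀ {w v d} → R w v → Zero w d → Zero v d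
  Zero-mono r h u s = h u (R-trans r s)

  Geq-mono : ∀ {w v d e} → R w v → Geq w d e → Geq v d e
  Geq-mono r h u s = h u (R-trans r s)

  Less-mono : ∀ {w v d e} → R w v → Less w d e → Less v d e
  Less-mono r h u s = h u (R-trans r s)

  Cover-mono : ∀ {w v d e} → R w v → Cover w d e → Cover v d e
  Cover-mono r h u s = h u (R-trans r s)

  Value-mono : ∀ m {w v d} → R w v → Value m w d → Value m v d
  Value-mono zero    r h = Zero-mono r h
  Value-mono (suc m) r (e , De , s₁ , s₂ , s₃ , val) =
    e , expand r De , Geq-mono r s₁ , Less-mono r s₂ , Cover-mono r s₃ , Value-mono m r val

  -- Supplies the witness for `positive`: predecessors lead down to value `K`, and each `Geq` on the
  -- way lifts the strict inequality.
  value-above : ∀ m K {w d} → Value (suc m + K) w d → ∃[ e ] D w e × Value K w e × Less w e d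
  value-above zero    K (e , De , _ , s₂ , _ , val) = e , De , val , s₂
  value-above (suc m) K (e , De , s₁ , _ , _ , val) with value-above m K val
  ... | f , Df , val′ , s = f , Df , val′ , λ v r Pd pv l → s₁ v r Pd pv λ Pe → s v r Pe pv l

  module _ {K : ℕ} where
    open Formulas K

    Cell : W → ℕ → ℕ → Set
    Cell w j m = ∃[ d ] D w d × Pᴹ w d × Row j w d × Value (K + m) w d

    Configuration : W → State → Set
    Configuration w c = (pᴹ w → Fᴹ w) × (∀ j → j < K → Cell w j (values c j))

    register-elim : ∀ {w g j m} → Sat 𝓜 w g (register j (value₀ (K + m))) → (Cell w j m → Fᴹ w) → Fᴹ w
    register-elim {w} {g} {j} {m} h k = h λ d Dd val row Pd →
      value₀-elim (K + m) w _ val λ val′ → k (d , Dd , Pd , row₀-elim j w _ row , val′)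

    transfer-elim : ∀ {w v g} x j u → Sat 𝓜 w g (transfer j u) → (∀ i → i < K → Cell w i (x i)) →
                    Bounded K u → Enabled u x → R w v → Pᴹ v (g 1) →
                    (Cell v j (update u x) → Fᴹ v) → Fᴹ v
    transfer-elim x j (const m) h cells _ _ r Pc k = register-elim {j = j} (h _ r Pc) k
    transfer-elim {w} {v} x j (keep i) h cells i<K _ r Pc k with cells i i<K
    ... | d , Dd , Pd , row , val = h d Dd Pd (row₀-intro i w _ row) v r Pc λ e De de ed row′ Pe →
      k (e , De , Pe , row₁-elim j v _ row′ , value-resp (K + x i) de ed (Value-mono (K + x i) r val))
    transfer-elim {w} {v} x j (up i) h cells i<K _ r Pc k with cells i i<K
    ... | d , Dd , Pd , row , val = h d Dd Pd (row₀-intro i w _ row) v r Pc λ e De s₁ s₂ s₃ row′ Pe →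
      k (e , De , Pe , row₁-elim j v _ row′ , subst (λ m → Value m v e) (sym (+-suc K (x i)))
        (d , expand r Dd , s₁ , s₂ , s₃ , Value-mono (K + x i) r val))
    transfer-elim {w} {v} x j (dn i) h cells i<K pos r Pc k with x i | cells i i<K
    ... | suc m | d , Dd , Pd , row , val
      with subst (λ m → Value m w d) (+-suc K m) val
    ... | e , De , s₁ , s₂ , s₃ , val′ =
      h d Dd Pd (row₀-intro i w _ row) v r Pc e (expand r De) (Geq-mono r s₁) (Less-mono r s₂) (Cover-mono r s₃)
        λ f Df ef fe row′ Pf →
      k (f , Df , Pf , row₀-elim j v _ row′ , value-resp (K + m) ef fe (Value-mono (K + m) r val′))

    transfers-intro : ∀ {w g} k u → ((∀ j → j < k → Sat 𝓜 w g (transfer j (u j))) → Fᴹ w) →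
                      Sat 𝓜 w g (transfers k u)
    transfers-intro zero    u h = h λ _ ()
    transfers-intro (suc k) u h t = transfers-intro k u λ ts → h (<-extend ts t)

    registers-intro : ∀ {w g} k n →
                      ((∀ j → j < k → Cell w j (values (initial n) j)) → Fᴹ w) →
                      Sat 𝓜 w g (registers k (value₀ (K + n)))
    registers-intro zero    n h = h λ _ ()
    registers-intro {w} {g} (suc k) n h t = registers-intro k n λ cells →
      register-elim {g = g} {k} (subst (λ φ → Sat 𝓜 w g (register k φ)) (content-initial k n) t) λ cell →
      h (<-extend cells cell)

    -- The diamond for the name is relative to `F`, so proving `F` at each world holding the name
    -- suffices. There the transfers provide all cells of the next configuration.
    successor-elim : ∀ {w g u c c′} → Sat 𝓜 w g (successor u) → Applies K u c c′ → Configuration w c →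
                     (∀ v → R w v → Configuration v c′ → Fᴹ v) → Fᴹ w
    successor-elim {u = u} {c} {c′} h app (_ , cells) k = h λ d Dd dia np → transfers-intro K u λ ts →
      dia λ v r Pd →
        collect K
          (λ j j<K → let bnd , en , eq = app j j<K in λ k →
            transfer-elim (values c) j (u j) (ts j j<K) cells bnd en r Pd
              λ cell → k (subst (Cell v j) eq cell))
          λ cells′ → k v r (np v r Pd , cells′)

    -- The new assignment holds the cells found at `v`, about which the users of the lemma make no
    -- assumption.
    at-elim : ∀ {w v g} ℓ φ {c} → 2 ≤ K → Sat 𝓜 w g (at ℓ φ) → R w v → Configuration v c →
              proj₁ c ≡ ℓ → ∃[ g′ ] Sat 𝓜 v g′ φ
    at-elim {v = v} {g} ℓ φ 2≤K h r (np , cells) refl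
      with cells 1 2≤K | cells 0 (≤-trans (s≤s z≤n) 2≤K)
    ... | d₁ , Dd₁ , Pd₁ , row₁ , _ | d₀ , Dd₀ , Pd₀ , row₀ , val =
      g₂ , h v r np d₁ Dd₁ Pd₁ (row₀-intro 1 v g₁ row₁) d₀ Dd₀ Pd₀ (row₀-intro 0 v g₂ row₀)
             (value₀-intro (K + ℓ) v g₂ Dd₀ val)
      where
      g₁ = _[_≔_] 𝓜 g 0 d₁
      g₂ = _[_≔_] 𝓜 g₁ 0 d₀

    ifZero-elim : ∀ {w g} i φ {c} → 2 + i ≤ K → Sat 𝓜 w g (ifZero i φ) → Configuration w c →
                  proj₂ c i ≡ 0 → ∃[ g′ ] Sat 𝓜 w g′ φ
    ifZero-elim {w} i φ i<K h (_ , cells) eq with cells (suc i) i<K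
    ... | d , Dd , Pd , row , val =
      _ , h d Dd Pd (row₀-intro (suc i) w _ row)
            (value₀-intro K w _ Dd
              (subst (λ m → Value m w d) (trans (cong (K +_) eq) (+-identityʳ K)) val))

    ifPositive-elim : ∀ {w g} i φ {c m} → 2 + i ≤ K → Sat 𝓜 w g (ifPositive i φ) → Configuration w c →
                      proj₂ c i ≡ suc m → ∃[ g′ ] Sat 𝓜 w g′ φ
    ifPositive-elim {w} i φ {m = m} i<K h (_ , cells) eq with cells (suc i) i<K
    ... | d , Dd , Pd , row , val
      with value-above m K (subst (λ m → Value m w d) (trans (cong (K +_) eq) (+-comm K (suc m))) val)
    ... | e , De , val′ , s =
      _ , h d Dd Pd (row₀-intro (suc i) w _ row) λ k → k e De (value₁-intro K w _ De val′) s

-- The curried axioms as a family indexed by addresses.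

module Axioms {W : Set} {R : Rel W Level.zero} {𝓕 : PFrame W R} (𝓜 : Model 𝓕) {K : ℕ} where
  open Formulas K

  AxiomAt : W → (ℕ → PFrame.U 𝓕) → ℕ → Instr → Set
  AxiomAt w g ℓ (set j s a) = Sat 𝓜 w g (at ℓ (successor (setU j s a)))
  AxiomAt w g ℓ (djz i a b) = Sat 𝓜 w g (at ℓ (ifZero i (successor (zeroU a)))) ×
                              Sat 𝓜 w g (at ℓ (ifPositive i (successor (decU i b))))

  AxiomsFrom : W → (ℕ → PFrame.U 𝓕) → ℕ → List Instr → Set
  AxiomsFrom w g ℓ Π = ∀ {i} a → fetch Π a ≡ just i → AxiomAt w g (ℓ + a) i

  axiomsFrom-∷ : ∀ {w g ℓ i Π} → AxiomAt w g ℓ i → AxiomsFrom w g (suc ℓ) Π → AxiomsFrom w g ℓ (i ∷ Π)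
  axiomsFrom-∷ {w} {g} {ℓ} {i} x xs zero    refl = subst (λ t → AxiomAt w g t i) (sym (+-identityʳ ℓ)) x
  axiomsFrom-∷ {w} {g} {ℓ} x xs {i} (suc a) eq   = subst (λ t → AxiomAt w g t i) (sym (+-suc ℓ a)) (xs a eq)

  axiomsFrom-head : ∀ {w g ℓ i Π} → AxiomsFrom w g ℓ (i ∷ Π) → AxiomAt w g ℓ i
  axiomsFrom-head {w} {g} {ℓ} {i} xs = subst (λ t → AxiomAt w g t i) (+-identityʳ ℓ) (xs 0 refl)

  axiomsFrom-tail : ∀ {w g ℓ i Π} → AxiomsFrom w g ℓ (i ∷ Π) → AxiomsFrom w g (suc ℓ) Π
  axiomsFrom-tail {w} {g} {ℓ} xs {i} a eq = subst (λ t → AxiomAt w g t i) (+-suc ℓ a) (xs (suc a) eq)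

  axioms-intro : ∀ {w g} ℓ Π φ → (AxiomsFrom w g ℓ Π → Sat 𝓜 w g φ) → Sat 𝓜 w g (axioms ℓ Π φ)
  axioms-intro ℓ []                φ h = h λ _ ()
  axioms-intro ℓ (set j s a ∷ Π) φ h x =
    axioms-intro (suc ℓ) Π φ λ xs → h (axiomsFrom-∷ {i = set j s a} x xs)
  axioms-intro ℓ (djz i a b ∷ Π) φ h x y =
    axioms-intro (suc ℓ) Π φ λ xs → h (axiomsFrom-∷ {i = djz i a b} (x , y) xs)

  axioms-elim : ∀ {w g} ℓ Π φ → Sat 𝓜 w g (axioms ℓ Π φ) → AxiomsFrom w g ℓ Π → Sat 𝓜 w g φ
  axioms-elim ℓ []              φ h xs = h
  axioms-elim ℓ (set j s a ∷ Π) φ h xs =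
    axioms-elim (suc ℓ) Π φ (h (axiomsFrom-head {i = set j s a} {Π} xs)) (axiomsFrom-tail {i = set j s a} {Π} xs)
  axioms-elim ℓ (djz i a b ∷ Π) φ h xs with axiomsFrom-head {i = djz i a b} {Π} xs
  ... | x , y = axioms-elim (suc ℓ) Π φ (h x y) (axiomsFrom-tail {i = djz i a b} {Π} xs)

haltingFormula : List Instr → ℕ → Form
haltingFormula Π n = halting Π (value₀ (registerBound Π + n))
  where open Formulas (registerBound Π)

module Simulation {W : Set} {R : Rel W Level.zero} (R-trans : ∀ {u v w} → R u v → R v w → R u w)
                  {𝓕 : PFrame W R} (𝓜 : Model 𝓕) (Π : List Instr) where

  K : ℕ
  K = registerBound Π

  open Semantics 𝓜
  open Derivation R-trans 𝓜
  open Formulas K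
  open Axioms 𝓜 {K}

  -- Induction on the length of the run: each axiom leads to an accessible world with the next
  -- configuration, and at the exit label the first premise yields `F`.
  simulate : ∀ {w₀ g₀} → Sat 𝓜 w₀ g₀ (at (length Π) F) → AxiomsFrom w₀ g₀ 0 Π →
             ∀ N c → HaltsIn Π N c → ∀ {w} → R w₀ w → Configuration {K} w c → Fᴹ w
  simulate halt axs zero    c h r conf = proj₂ (at-elim (length Π) F (2≤registerBound Π) halt r conf h)
  simulate halt axs (suc N) (a , ρ) h r conf with fetch Π a in eq
  ... | nothing = simulate halt axs N (a , ρ) h r conf
  ... | just (set j s x)
    with at-elim a (successor (setU j s x)) (2≤registerBound Π) (axs a eq) r conf refl
  ... | _ , h′ = successor-elim {u = setU j s x} h′ (setU-applies a j s x ρ (instrBound≤ Π a eq)) conf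
                   λ v r′ conf′ → simulate halt axs N _ h (R-trans r r′) conf′
  simulate halt axs (suc N) (a , ρ) h r conf | just (djz i x y) with ρ i in ρi
  ... | zero
    with at-elim a (ifZero i (successor (zeroU x))) (2≤registerBound Π) (proj₁ (axs a eq)) r conf refl
  ... | _ , h₁ with ifZero-elim i (successor (zeroU x)) (instrBound≤ Π a eq) h₁ conf ρi
  ... | _ , h₂ = successor-elim {u = zeroU x} h₂ (zeroU-applies a x ρ) conf
                   λ v r′ conf′ → simulate halt axs N _ h (R-trans r r′) conf′
  simulate halt axs (suc N) (a , ρ) h r conf | just (djz i x y) | suc m
    with at-elim a (ifPositive i (successor (decU i y))) (2≤registerBound Π) (proj₂ (axs a eq)) r conf refl
  ... | _ , h₁ with ifPositive-elim i (successor (decU i y)) (instrBound≤ Π a eq) h₁ conf ρi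
  ... | _ , h₂ = successor-elim {u = decU i y} h₂ (decU-applies a i y ρ (instrBound≤ Π a eq) ρi) conf
                   λ v r′ conf′ → simulate halt axs N _ h (R-trans r r′) conf′

  halting-valid : ∀ n → ∃[ N ] HaltsIn Π N (initial n) → ∀ w g → Sat 𝓜 w g (haltingFormula Π n)
  halting-valid n (N , h) w g halt = axioms-intro 0 Π (start (value₀ (K + n)) ⇒ F) λ axs st →
    st λ v r np → registers-intro K n λ cells → simulate halt axs N (initial n) h r (np , cells)

-- The canonical model

-- 0, 1 0, 2 1 0, 3 2 1 0, …: every number occurs infinitely often.
countdown : ℕ → ℕ × ℕ
countdown zero    = 0 , 0
countdown (suc k) with countdown k
... | zero  , b = suc b , suc b
... | suc a , b = a , b

countdown-restart : ∀ k {b} → countdown k ≡ (0 , b) → countdown (suc k) ≡ (suc b , suc b)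
countdown-restart k eq rewrite eq = refl

countdown-down : ∀ k {a b} → countdown k ≡ (suc a , b) → countdown (suc k) ≡ (a , b)
countdown-down k eq rewrite eq = refl

countdown-reach : ∀ d a {b} k → countdown k ≡ (d + a , b) → ∃[ k′ ] k ≤ k′ × countdown k′ ≡ (a , b)
countdown-reach zero    a k eq = k , ≤-refl , eq
countdown-reach (suc d) a k eq with countdown-reach d a (suc k) (countdown-down k eq)
... | k′ , k<k′ , eq′ = k′ , <⇒≤ k<k′ , eq′

countdown-next : ∀ k {a b} → countdown k ≡ (a , b) → ∃[ k′ ] k < k′ × countdown k′ ≡ (suc b , suc b)
countdown-next k {a} eq
  with countdown-reach a 0 k (trans eq (cong (_, _) (sym (+-identityʳ a))))
... | k′ , k≤k′ , eq′ = suc k′ , s≤s k≤k′ , countdown-restart k′ eq′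

-- Each descent starts one higher than the previous one.
countdown-large : ∀ m k → ∃[ k′ ] ∃[ b ] k < k′ × countdown k′ ≡ (suc (m + b) , suc (m + b))
countdown-large zero k with countdown k in eq
... | a , b with countdown-next k eq
... | k′ , k<k′ , eq′ = k′ , b , k<k′ , eq′
countdown-large (suc m) k with countdown-large m k
... | k′ , b , k<k′ , eq with countdown-next k′ eq
... | k″ , k′<k″ , eq′ = k″ , b , <-trans k<k′ k′<k″ , eq′

-- A descent that starts beyond `k` and above `a` passes through `a`.
countdown-recurs : ∀ a k → ∃[ k′ ] k < k′ × proj₁ (countdown k′) ≡ a
countdown-recurs a k with countdown-large a k
... | k′ , b , k<k′ , eq
  with countdown-reach (suc b) a k′ (trans eq (cong (λ x → x , suc (a + b)) (cong suc (+-comm a b))))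
... | k″ , k′≤k″ , eq′ = k″ , ≤-trans k<k′ k′≤k″ , cong proj₁ eq′

data WorldType : Set where
  downset row conf : ℕ → WorldType

next-type : WorldType → WorldType
next-type (downset i) = downset (suc i)
next-type (row i)     = row (suc i)
next-type (conf i)    = conf (suc i)

-- The residue modulo 3 selects the family, the quotient the index.
decode : ℕ → WorldType
decode 0 = downset 0
decode 1 = row 0
decode 2 = conf 0
decode (suc (suc (suc k))) = next-type (decode k)

decode-surjective : ∀ T → ∃[ k ] decode k ≡ T
decode-surjective (downset zero)    = 0 , refl
decode-surjective (row zero)        = 1 , refl
decode-surjective (conf zero)       = 2 , refl
decode-surjective (downset (suc i)) with decode-surjective (downset i)
... | k , eq = 3 + k , cong next-type eq
decode-surjective (row (suc i)) with decode-surjective (row i)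
... | k , eq = 3 + k , cong next-type eq
decode-surjective (conf (suc i)) with decode-surjective (conf i)
... | k , eq = 3 + k , cong next-type eq

τ : ℕ → WorldType
τ k = decode (proj₁ (countdown k))

τ-recurs : ∀ T k → ∃[ k′ ] k < k′ × τ k′ ≡ T
τ-recurs T k with decode-surjective T
... | a , eq with countdown-recurs a k
... | k′ , k<k′ , eq′ = k′ , k<k′ , trans (cong decode eq′) eq

data Element : Set where
  cell : (i w : ℕ) → Element
  name : ℕ → Element

cell-injective : ∀ {i j v w} → cell i v ≡ cell j w → i ≡ j × v ≡ w
cell-injective refl = refl , refl

-- The model, and the meaning of the formulas on the chain.

module Canonical {W : Set} {R : Rel W Level.zero} (c : ℕ → W) (c-injective : ∀ i j → c i ≡ c j → i ≡ j)
                 (c-mono : ∀ {i j} → i < j → R (c i) (c j)) (Π : List Instr) (n : ℕ) where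

  K : ℕ
  K = registerBound Π

  configuration : ℕ → State
  configuration t = run Π t (initial n)

  H : Set
  H = ∃[ N ] HaltsIn Π N (initial n)

  infix 4 _∋_
  -- Row `i` has the cells that can store contents of register `i`, and the marker `cell i i`, by
  -- which `row₀ i` recognises it when `i < K`.
  _∋_ : WorldType → Element → Set
  downset m ∋ cell i w = w ≤ m
  downset m ∋ name t   = ⊥
  row i     ∋ cell j w = i ≡ j × (K ≤ w ⊎ w ≡ i)
  row i     ∋ name t   = ⊥
  conf t    ∋ cell j w = j < K × w ≡ K + values (configuration t) j
  conf t    ∋ name s   = s ≡ t

  𝓕 : PFrame W R
  𝓕 = record { U = Element ; D = λ _ _ → ⊤ ; nonempty = λ _ → name 0 , tt ; expand = λ _ _ → tt }

  -- Lying on the chain need not be decidable, so the index is part of the evidence; injectivity of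
  -- the chain makes it unique. The summand `H` makes `p` true everywhere once the machine halts.
  Interpretation : W → (n P : ℕ) → Vec Element n → Set
  Interpretation w 0 0 []       = (∃[ k ] w ≡ c k × ∃[ m ] τ k ≡ downset m) ⊎ H
  Interpretation w 1 0 (d ∷ []) = ∃[ k ] w ≡ c k × τ k ∋ d
  Interpretation w _ _ _        = ⊥

  𝓜 : Model 𝓕
  𝓜 = record { I = Interpretation ; I-dom = λ {_} {_} {_} {ds} _ → All.universal (λ _ → tt) ds }

  open Semantics 𝓜
  open Formulas K
  open Axioms 𝓜 {K}

  toF : ∀ {w} → H → Fᴹ w
  toF h _ _ = inj₂ h

  member : ∀ {k d T} → τ k ≡ T → Pᴹ (c k) d → T ∋ d
  member {k} {d} refl (k′ , eq , x) = subst (λ k → τ k ∋ d) (sym (c-injective k k′ eq)) x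

  P-intro : ∀ {k d T} → τ k ≡ T → T ∋ d → Pᴹ (c k) d
  P-intro {k} {d} eq x = k , refl , subst (_∋ d) (sym eq) x

  p-elim : ∀ {k T} → τ k ≡ T → pᴹ (c k) → (∃[ m ] T ≡ downset m) ⊎ H
  p-elim {k} refl (inj₁ (k′ , eq , m , eq′)) = inj₁ (m , trans (cong τ (c-injective k k′ eq)) eq′)
  p-elim refl (inj₂ h) = inj₂ h

  p-intro : ∀ {k m} → τ k ≡ downset m → pᴹ (c k)
  p-intro {k} {m} eq = inj₁ (k , refl , m , eq)

  not-downset : ∀ {k T} → τ k ≡ T → (∀ {m} → T ≢ downset m) → pᴹ (c k) → H
  not-downset eq T≢ pk with p-elim eq pk
  ... | inj₁ (m , eq′) = ⊥-elim (T≢ eq′)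
  ... | inj₂ h = h

  visit : ∀ T k {X : Set} → (∀ k′ → R (c k) (c k′) → τ k′ ≡ T → X) → X
  visit T k h = let k′ , k<k′ , eq = τ-recurs T k in h k′ (c-mono k<k′) eq

  -- Some later world is a row, and there `p` can only hold because of `H`.
  fromF : ∀ {k} → Fᴹ (c k) → H
  fromF {k} f = visit (row 0) k λ k′ r eq → not-downset eq (λ ()) (f (c k′) r)

  on-downset : ∀ {v d} → Pᴹ v d → pᴹ v →
               (∀ k m → v ≡ c k → τ k ≡ downset m → downset m ∋ d → Fᴹ v) → Fᴹ v
  on-downset Pd (inj₂ h) f = toF h
  on-downset Pd (inj₁ (k , refl , m , eq)) f = f k m refl eq (member eq Pd)

  zero-intro : ∀ w i → Zero w (cell i 0)
  zero-intro w i v r (inj₂ h) k = toF h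
  zero-intro w i v r (inj₁ (k′ , refl , m , eq)) k = k (P-intro eq z≤n)

  geq-intro : ∀ {x y} w i j → y ≤ x → Geq w (cell i x) (cell j y)
  geq-intro w i j y≤x v r Pd pv k = on-downset Pd pv λ { _ m refl eq x≤m → k (P-intro eq (≤-trans y≤x x≤m)) }

  last-intro : ∀ {k m} i → τ k ≡ downset m → Last (c k) (cell i m)
  last-intro i eq (cell j w) _ Pe = geq-intro _ i j (member eq Pe)
  last-intro i eq (name _)   _ Pe = ⊥-elim (member eq Pe)

  -- The downset of `w` recurs later and contains `cell i w`, hence by maximality also `cell 0 m`.
  last-elim : ∀ {k m i w} → τ k ≡ downset m → Last (c k) (cell i w) → (m ≤ w → H) → H
  last-elim {k} {m} {i} {w} eq l h = visit (downset w) k λ k′ r eq′ →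
    fromF (l (cell 0 m) tt (P-intro eq ≤-refl) (c k′) r (P-intro eq′ ≤-refl) (p-intro eq′)
            λ Pe → toF (h (member eq′ Pe)))

  less-intro : ∀ {x y} w i j → x < y → Less w (cell i x) (cell j y)
  less-intro w i j x<y v r Pe pv l = on-downset Pe pv λ { _ m refl eq y≤m →
    toF (last-elim eq l λ m≤x → ⊥-elim (<⇒≱ x<y (≤-trans y≤m m≤x))) }

  cover-intro : ∀ {x} w i j → Cover w (cell i x) (cell j (suc x))
  cover-intro {x} w i j v r Pd pv nl k = on-downset Pd pv λ { _ m refl eq x≤m → case eq x≤m }
    where
    case : ∀ {k m} → τ k ≡ downset m → x ≤ m → {{v ≡ c k}} → Fᴹ v
    case eq x≤m {{refl}} with m≤n⇒m<n∨m≡n x≤m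
    ... | inj₁ x<m  = k (P-intro eq x<m)
    ... | inj₂ refl = nl (last-intro i eq)

  -- In the downset of `suc w` the cell of value `w` is not last, so `e` belongs to it and is a
  -- cell. Were its value at most `w`, the downset of `w` would refute `Less`.
  cover-elim : ∀ {k i w e} → Less (c k) (cell i w) e → Cover (c k) (cell i w) e →
               (∀ j → e ≡ cell j (suc w) → H) → H
  cover-elim {k} {i} {w} {e} less cover h = visit (downset (suc w)) k λ k′ r eq →
    fromF (cover (c k′) r (P-intro eq (n≤1+n w)) (p-intro eq)
      (λ l → toF (last-elim eq l λ sw≤w → ⊥-elim (<⇒≱ ≤-refl sw≤w)))
      (λ Pe → toF (case e (member eq Pe) refl)))
    where
    case : ∀ e′ → downset (suc w) ∋ e′ → e ≡ e′ → H
    case (cell j w′) w′≤sw refl with m≤n⇒m<n∨m≡n w′≤sw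
    ... | inj₁ w′<sw = visit (downset w) k λ k′ r eq →
      fromF (less (c k′) r (P-intro eq (≤-pred w′<sw)) (p-intro eq) (last-intro i eq))
    ... | inj₂ refl = h j refl

  value-intro : ∀ m w i → Value m w (cell i m)
  value-intro zero    w i = zero-intro w i
  value-intro (suc m) w i =
    cell i m , tt , geq-intro w i i (n≤1+n m) , less-intro w i i ≤-refl , cover-intro w i i , value-intro m w i

  value-elim : ∀ m {k d} → Value m (c k) d → (∀ i → d ≡ cell i m → H) → H
  value-elim zero {k} {d} z h = visit (downset 0) k λ k′ r eq →
    fromF (z (c k′) r (p-intro eq) λ Pd → toF (case d (member eq Pd) refl))
    where
    case : ∀ d′ → downset 0 ∋ d′ → d ≡ d′ → H
    case (cell i .0) z≤n eq = h i eq
  value-elim (suc m) (e , _ , _ , less , cover , val) h =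
    value-elim m val λ { i refl → cover-elim less cover h }

  -- Tested at a later world of row `i`, whose marker has value `i`.
  row-elim : ∀ {i k d} → Row i (c k) d → (row i ∋ d → H) → H
  row-elim {i} {k} rw h = visit (row i) k λ k′ r eq →
    fromF (rw (c k′) r (cell i i) tt (P-intro eq (refl , inj₂ refl)) (value-intro i _ i)
      (λ pv → toF (not-downset eq (λ ()) pv)) λ Pd → toF (h (member eq Pd)))

  -- A world with a cell of value `i < K` is a downset, excluded up to `F`, or row `i` itself:
  -- configurations have only values from `K` on, and below `K` another row has at most its own
  -- marker.
  row-intro : ∀ {i x} w → i < K → K ≤ x → Row i w (cell i x)
  row-intro {i} {x} w i<K K≤x v r e _ (k , refl , e∈) val np nP = toF (value-elim i val (case (τ k) refl))
    where
    case : ∀ T → τ k ≡ T → ∀ j → e ≡ cell j i → H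
    case (downset m) eq j refl = fromF (np (p-intro eq))
    case (row l) eq j refl with subst (_∋ e) eq e∈
    ... | refl , inj₁ K≤i = ⊥-elim (<⇒≱ i<K K≤i)
    ... | refl , inj₂ refl = fromF (nP (P-intro eq (refl , inj₁ K≤x)))
    case (conf t) eq j refl with subst (_∋ e) eq e∈
    ... | _ , i≡ = ⊥-elim (<⇒≱ i<K (subst (K ≤_) (sym i≡) (m≤m+n K _)))

  -- The elimination lemmas above conclude only `H`. Stable formulas can still be proved with them;
  -- `F` is stable because it amounts to `H` on the chain, and a conclusion passes stability on.
  Stable : Form → Set
  Stable φ = ∀ k g → ((Sat 𝓜 (c k) g φ → H) → H) → Sat 𝓜 (c k) g φ

  stable-F : Stable F
  stable-F k g h = toF (h fromF)

  stable-⇒ : ∀ φ ψ → Stable ψ → Stable (φ ⇒ ψ)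
  stable-⇒ φ ψ s k g h x = s k g λ f → h λ y → f (y x)

  stable-∀ : ∀ x φ → Stable φ → Stable (∀' x φ)
  stable-∀ x φ s k g h d Dd = s k _ λ f → h λ y → f (y d Dd)

  at-intro : ∀ {w g} ℓ φ → Stable φ →
             (∀ {t k} g → τ k ≡ conf t → proj₁ (configuration t) ≡ ℓ → Sat 𝓜 (c k) g φ) →
             Sat 𝓜 w g (at ℓ φ)
  at-intro {w} {g} ℓ φ st h v r np d₁ _ (k , refl , x₁) row₁ d₀ _ (k₀ , ck₀ , x₀) row₀ val =
    st k g₀ λ f →
      row-elim (row₀-elim 1 v g₁ row₁) λ y₁ →
      row-elim (row₀-elim 0 v g₀ row₀) λ y₀ →
      fromF (value₀-elim (K + ℓ) v g₀ val λ val′ → toF (value-elim (K + ℓ) val′ λ i → λ { refl →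
        case (τ k) refl y₁ y₀ (subst (λ k → τ k ∋ d₀) (sym (c-injective k k₀ ck₀)) x₀) x₁ f }))
    where
    g₁ = _[_≔_] 𝓜 g 0 d₁
    g₀ = _[_≔_] 𝓜 g₁ 0 d₀
    case : ∀ T → τ k ≡ T → ∀ {d₁ i} → row 1 ∋ d₁ → row 0 ∋ cell i (K + ℓ) → T ∋ cell i (K + ℓ) → T ∋ d₁ →
           (Sat 𝓜 (c k) g₀ φ → H) → H
    case (downset m) eq y₁ y₀ x₀ x₁ f = fromF (np (p-intro eq))
    case (row i) eq {cell _ _} (refl , _) (refl , _) (() , _) (refl , _) f
    case (conf t) eq y₁ (refl , _) (_ , e) x₁ f = f (h g₀ eq (sym (+-cancelˡ-≡ K _ _ e)))

  -- The axioms hold at the configurations of the run.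

  module _ {t k} (τk : τ k ≡ conf t) where

    private
      x : ℕ → ℕ
      x = values (configuration t)

    source-elim : ∀ i g → Pᴹ (c k) (g 0) → Sat 𝓜 (c k) g (row₀ i) → (g 0 ≡ cell i (K + x i) → H) → H
    source-elim i g Pd rw h = row-elim (row₀-elim i (c k) g rw) λ y → case (g 0) y (member τk Pd) h
      where
      case : ∀ d → row i ∋ d → conf t ∋ d → (d ≡ cell i (K + x i) → H) → H
      case (cell _ _) (refl , _) (_ , refl) h = h refl

    ifZero-intro : ∀ {g} i φ → Stable φ → (x (suc i) ≡ 0 → ∀ g → Sat 𝓜 (c k) g φ) →
                   Sat 𝓜 (c k) g (ifZero i φ)
    ifZero-intro {g} i φ st h d _ Pd rw val = st k g′ λ f →
      source-elim (suc i) g′ Pd rw λ eq →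
      fromF (value₀-elim K (c k) g′ val λ val′ → toF (value-elim K val′ λ j eq′ →
        f (h (m+n≡m⇒n≡0 (proj₂ (cell-injective (trans (sym eq) eq′)))) g′)))
      where
      g′ = _[_≔_] 𝓜 g 0 d
      m+n≡m⇒n≡0 : ∀ {n} → K + n ≡ K → n ≡ 0
      m+n≡m⇒n≡0 e = +-cancelˡ-≡ K _ _ (trans e (sym (+-identityʳ K)))

    less-elim : ∀ {i j w} → Less (c k) (cell j K) (cell i (K + w)) → (0 < w → H) → H
    less-elim {i} {j} {zero} l h = visit (downset K) k λ k′ r eq →
      fromF (l (c k′) r (P-intro eq (≤-reflexive (+-identityʳ K))) (p-intro eq) (last-intro j eq))
    less-elim {w = suc w} l h = h (s≤s z≤n)

    ifPositive-intro : ∀ {g} i φ → Stable φ → (0 < x (suc i) → ∀ g → Sat 𝓜 (c k) g φ) →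
                       Sat 𝓜 (c k) g (ifPositive i φ)
    ifPositive-intro {g} i φ st h d _ Pd rw pos = st k g′ λ f →
      source-elim (suc i) g′ Pd rw λ eq →
      fromF (pos λ e _ val l → value₁-elim K (c k) (_[_≔_] 𝓜 g′ 1 e) val λ val′ →
        toF (value-elim K val′ λ j eq′ →
          less-elim (subst₂ (Less (c k)) eq′ eq l) λ 0<x → f (h 0<x g′)))
      where
      g′ = _[_≔_] 𝓜 g 0 d

    -- Only configurations contain names. In particular `v` lies on the chain, as `fromF` requires.
    name-world : ∀ {v s} → Pᴹ v (name s) → ∃[ k′ ] v ≡ c k′ × τ k′ ≡ conf s
    name-world (k′ , eq , y) = k′ , eq , case (τ k′) refl y
      where
      case : ∀ T {s} → τ k′ ≡ T → T ∋ name s → τ k′ ≡ conf s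
      case (conf s) eq refl = eq

    Successor : Update → ℕ → Set
    Successor u j = Bounded K u × Enabled u x × update u x ≡ values (configuration (suc t)) j

    successor-cell : ∀ {v} j u → j < K → Successor u j → Pᴹ v (name (suc t)) → Pᴹ v (cell j (K + update u x))
    successor-cell {v} j u j<K (_ , _ , eq) Pc =
      let k′ , v≡ , τ≡ = name-world Pc in
      k′ , v≡ , subst (_∋ cell j (K + update u x)) (sym τ≡) (j<K , cong (K +_) eq)

    transfer-intro : ∀ {g} j u → j < K → Successor u j →
                     Sat 𝓜 (c k) (_[_≔_] 𝓜 g 1 (name (suc t))) (transfer j u)
    transfer-intro {g} j (const m) j<K s v r Pc h =
      h (cell j (K + m)) tt (value₀-intro (K + m) v g′ tt (value-intro (K + m) v j))
        (row₀-intro j v g′ (row-intro v j<K (m≤m+n K m))) (successor-cell j (const m) j<K s Pc)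
      where
      g′ = _[_≔_] 𝓜 (_[_≔_] 𝓜 g 1 (name (suc t))) 0 (cell j (K + m))
    transfer-intro {g} j (keep i) j<K s d _ Pd rw v r Pc h =
      toF (source-elim i g′ Pd rw λ { refl →
        let k′ , v≡ , _ = name-world Pc in
        fromF (subst Fᴹ v≡ (h (cell j (K + x i)) tt (geq-intro v i j ≤-refl) (geq-intro v j i ≤-refl)
          (row₁-intro j v (g″ (cell j (K + x i))) (row-intro v j<K (m≤m+n K _)))
          (successor-cell j (keep i) j<K s Pc))) })
      where
      g′ = _[_≔_] 𝓜 (_[_≔_] 𝓜 g 1 (name (suc t))) 0 d
      g″ = _[_≔_] 𝓜 g′ 1
    transfer-intro {g} j (up i) j<K s d _ Pd rw v r Pc h =
      toF (source-elim i g′ Pd rw λ { refl →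
        let k′ , v≡ , _ = name-world Pc in
        fromF (subst Fᴹ v≡ (h (cell j (suc (K + x i))) tt (geq-intro v j i (n≤1+n _))
          (less-intro v i j ≤-refl) (cover-intro v i j)
          (row₁-intro j v (g″ (cell j (suc (K + x i)))) (row-intro v j<K (≤-trans (m≤m+n K (x i)) (n≤1+n _))))
          (subst (λ w → Pᴹ v (cell j w)) (+-suc K (x i)) (successor-cell j (up i) j<K s Pc)))) })
      where
      g′ = _[_≔_] 𝓜 (_[_≔_] 𝓜 g 1 (name (suc t))) 0 d
      g″ = _[_≔_] 𝓜 g′ 1
    transfer-intro {g} j (dn i) j<K s@(_ , pos , _) d _ Pd rw v r Pc e _ ge le co h =
      toF (source-elim i g′ Pd rw λ eq →
        let k′ , v≡ , _ = name-world Pc in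
        predecessor-elim k′ (subst (λ v → Geq v (cell i (K + x i)) e) v≡ (subst (λ d → Geq v d e) eq ge))
            (subst₂ (λ v → Less v e) v≡ eq le) (subst₂ (λ v → Cover v e) v≡ eq co) pos λ { j′ refl →
        fromF (subst Fᴹ v≡ (h (cell j (K + pred (x i))) tt
          (geq-intro v j′ j ≤-refl) (geq-intro v j j′ ≤-refl)
          (row₀-intro j v (g″ (cell j (K + pred (x i)))) (row-intro v j<K (m≤m+n K _)))
          (successor-cell j (dn i) j<K s Pc))) })
      where
      g′ = _[_≔_] 𝓜 (_[_≔_] 𝓜 g 1 (name (suc t))) 0 d
      g″ = _[_≔_] 𝓜 (_[_≔_] 𝓜 g′ 1 e) 0
      predecessor-elim : ∀ {e i y} k′ → Geq (c k′) (cell i (K + y)) e → Less (c k′) e (cell i (K + y)) →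
                         Cover (c k′) e (cell i (K + y)) → 0 < y → (∀ j′ → e ≡ cell j′ (K + pred y) → H) → H
      -- `Geq` places `e` in a downset, so it is a cell; `cover-elim` then determines its value.
      predecessor-elim {e} {i} {suc y} k′ ge le co _ h = visit (downset (K + suc y)) k′ λ k″ r eq →
        fromF (ge (c k″) r (P-intro eq ≤-refl) (p-intro eq) λ Pe → toF (case e (member eq Pe) refl))
        where
        case : ∀ e′ → downset (K + suc y) ∋ e′ → e ≡ e′ → H
        case (cell j′ w) _ refl = cover-elim le co λ _ eq →
          h j′ (cong (cell j′) (suc-injective (sym (trans (sym (+-suc K y)) (proj₂ (cell-injective eq))))))

    transfers-elim : ∀ {g} l u → Sat 𝓜 (c k) g (transfers l u) →
                     (∀ j → j < l → Sat 𝓜 (c k) g (transfer j (u j))) → Fᴹ (c k)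
    transfers-elim zero    u h ts = h
    transfers-elim (suc l) u h ts =
      transfers-elim l u (h (ts l ≤-refl)) λ j j<l → ts j (≤-trans j<l (n≤1+n l))

    successor-intro : ∀ {g} u → Applies K u (configuration t) (configuration (suc t)) →
                      Sat 𝓜 (c k) g (successor u)
    successor-intro {g} u app h =
      transfers-elim K u
        -- The witness is the name of the next configuration, which recurs beyond `k`; no downset
        -- contains a name.
        (h (name (suc t)) tt
          (λ dia → visit (conf (suc t)) k λ k′ r eq → toF (fromF (dia (c k′) r (P-intro eq refl))))
          (λ v r Pc pv → on-downset Pc pv λ _ _ _ _ → λ ()))
        λ j j<K → transfer-intro {g} j (u j) j<K (app j j<K)

  stable-successor : ∀ u → Stable (successor u)
  stable-successor u = stable-⇒ (∀' 1 (~ □ (P 1 ⇒ F) ⇒ □ (P 1 ⇒ p ⇒ F) ⇒ transfers K u)) F stable-F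

  stable-test : ∀ i ψ φ → Stable φ → Stable (∀' 0 (P 0 ⇒ row₀ (suc i) ⇒ ψ ⇒ φ))
  stable-test i ψ φ st =
    stable-∀ 0 (P 0 ⇒ row₀ (suc i) ⇒ ψ ⇒ φ) (stable-⇒ (P 0) (row₀ (suc i) ⇒ ψ ⇒ φ)
      (stable-⇒ (row₀ (suc i)) (ψ ⇒ φ) (stable-⇒ ψ φ st)))

  configuration-suc : ∀ t {i} → fetch Π (proj₁ (configuration t)) ≡ just i →
                      configuration (suc t) ≡ exec i (proj₂ (configuration t))
  configuration-suc t eq = trans (run-suc Π t (initial n)) (cong (maybe′ _ _) eq)

  decrement-zero : ∀ {v} a b i ρ → v ≡ 0 → decrement v a b i ρ ≡ (a , ρ)
  decrement-zero a b i ρ refl = refl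

  axiom-holds : ∀ {w g} ℓ i → fetch Π ℓ ≡ just i → AxiomAt w g ℓ i
  axiom-holds ℓ (set j s a) eq = at-intro ℓ (successor (setU j s a)) (stable-successor (setU j s a))
    λ { {t} g τk refl → successor-intro τk (setU j s a)
      (subst (Applies K _ _) (sym (configuration-suc t eq))
        (setU-applies _ j s a (proj₂ (configuration t)) (instrBound≤ Π _ eq))) }
  axiom-holds ℓ (djz i a b) eq =
    at-intro ℓ (ifZero i (successor (zeroU a)))
      (stable-test i (value₀ K) (successor (zeroU a)) (stable-successor (zeroU a)))
      (λ { {t} g τk refl → ifZero-intro τk i (successor (zeroU a)) (stable-successor (zeroU a)) λ ρi g′ →
        successor-intro τk (zeroU a)
          (subst (Applies K _ _) (sym (trans (configuration-suc t eq) (decrement-zero a b i _ ρi)))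
            (zeroU-applies _ a (proj₂ (configuration t)))) }) ,
    at-intro ℓ (ifPositive i (successor (decU i b)))
      (stable-test i positive (successor (decU i b)) (stable-successor (decU i b)))
      (λ { {t} g τk refl → ifPositive-intro τk i (successor (decU i b)) (stable-successor (decU i b)) λ ρi g′ →
        successor-intro τk (decU i b) (positive-case t eq ρi) })
    where
    positive-case : ∀ t → fetch Π (proj₁ (configuration t)) ≡ just (djz i a b) → 0 < proj₂ (configuration t) i →
                    Applies K (decU i b) (configuration t) (configuration (suc t))
    positive-case t eq 0<ρi = case _ refl 0<ρi
      where
      case : ∀ y → proj₂ (configuration t) i ≡ y → 0 < y →
             Applies K (decU i b) (configuration t) (configuration (suc t))
      case (suc y) ρi _ =
        subst (Applies K _ _)
          (sym (trans (configuration-suc t eq) (cong (λ v → decrement v a b i (proj₂ (configuration t))) ρi)))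
          (decU-applies _ i b (proj₂ (configuration t)) (instrBound≤ Π _ eq) ρi)

  -- The index of a configuration at the exit label is itself the number of steps that `H` asks for.
  halt-holds : ∀ {w g} → Sat 𝓜 w g (at (length Π) F)
  halt-holds = at-intro (length Π) F stable-F λ {t} _ _ eq → toF (t , eq)

  registers-elim : ∀ {g k} l → l ≤ K → τ k ≡ conf 0 → Sat 𝓜 (c k) g (registers l (value₀ (K + n))) → Fᴹ (c k)
  registers-elim zero    _   _  h = h
  registers-elim {g} {k} (suc l) l<K eq h =
    registers-elim l (<⇒≤ l<K) eq
    (h (register-intro (content-initial l n)))
    where
    m = values (initial n) l
    register-intro : ∀ {φ} → φ ≡ value₀ (K + m) → Sat 𝓜 (c k) g (register l φ)
    register-intro refl h =
      h (cell l (K + m)) tt (value₀-intro (K + m) (c k) g′ tt (value-intro (K + m) (c k) l))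
        (row₀-intro l (c k) g′ (row-intro (c k) l<K (m≤m+n K m))) (P-intro eq (l<K , refl))
      where
      g′ = _[_≔_] 𝓜 g 0 (cell l (K + m))

  start-holds : ∀ {g k} → Sat 𝓜 (c k) g (start (value₀ (K + n)))
  start-holds {k = k} h = visit (conf 0) k λ k′ r eq →
    toF (fromF (registers-elim K ≤-refl eq (h (c k′) r λ pv → toF (not-downset eq (λ ()) pv))))

  -- All premises hold at `c 0`, so the formula yields `F` there, which is halting.
  halting-reflects : ∀ {g} → Sat 𝓜 (c 0) g (haltingFormula Π n) → H
  halting-reflects h =
    fromF (axioms-elim 0 Π (start (value₀ (K + n)) ⇒ F) (h halt-holds) (λ a eq → axiom-holds a _ eq) start-holds)

-- The reduction

v₀ : IsVar01 0
v₀ = inj₁ refl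

v₁ : IsVar01 1
v₁ = inj₂ refl

module _ {a b : ℕ} (va : IsVar01 a) (vb : IsVar01 b) where

  geq-inLang : InLang (geq a b)
  geq-inLang = va , tt , (vb , tt) , tt

  last-inLang : InLang (last a b)
  last-inLang = vb , vb , geq-inLang

  less-inLang : InLang (less a b)
  less-inLang = vb , tt , last-inLang , tt

  cover-inLang : InLang (cover a b)
  cover-inLang = va , tt , (last-inLang , tt) , (vb , tt) , tt

value₁∘-inLang : ∀ φ → InLang φ → InLang (value₁∘ φ)
value₁∘-inLang φ x = (v₀ , geq-inLang v₁ v₀ , geq-inLang v₀ v₁ , x , tt) , tt

value₀-inLang : ∀ m → InLang (value₀ m)
value₀-inLang zero    = tt , (v₀ , tt) , tt
value₀-inLang (suc m) =
  (v₁ , geq-inLang v₀ v₁ , less-inLang v₁ v₀ , cover-inLang v₁ v₀ ,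
    value₁∘-inLang (value₀ m) (value₀-inLang m) , tt) , tt

value₁-inLang : ∀ m → InLang (value₁ m)
value₁-inLang m = value₁∘-inLang (value₀ m) (value₀-inLang m)

row₀-inLang : ∀ i → InLang (row₀ i)
row₀-inLang i = v₁ , v₁ , value₁-inLang i , (tt , tt) , (v₀ , tt) , tt

row₁-inLang : ∀ i → InLang (row₁ i)
row₁-inLang i = v₀ , v₀ , value₀-inLang i , (tt , tt) , (v₁ , tt) , tt

module _ (K : ℕ) where
  open Formulas K

  register-inLang : ∀ j φ → InLang φ → InLang (register j φ)
  register-inLang j φ x = (v₀ , x , row₀-inLang j , v₀ , tt) , tt

  transfer-inLang : ∀ j u → InLang (transfer j u)
  transfer-inLang j (const m) = v₁ , register-inLang j (value₀ (K + m)) (value₀-inLang (K + m))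
  transfer-inLang j (keep i)  =
    v₀ , v₀ , row₀-inLang i , v₁ , (v₁ , geq-inLang v₀ v₁ , geq-inLang v₁ v₀ , row₁-inLang j , v₁ , tt) , tt
  transfer-inLang j (up i)    =
    v₀ , v₀ , row₀-inLang i , v₁ ,
    (v₁ , geq-inLang v₁ v₀ , less-inLang v₀ v₁ , cover-inLang v₀ v₁ , row₁-inLang j , v₁ , tt) , tt
  transfer-inLang j (dn i)    =
    v₀ , v₀ , row₀-inLang i , v₁ , v₁ , geq-inLang v₀ v₁ , less-inLang v₁ v₀ , cover-inLang v₁ v₀ ,
    (v₀ , geq-inLang v₁ v₀ , geq-inLang v₀ v₁ , row₀-inLang j , v₀ , tt) , tt

  transfers-inLang : ∀ k u → InLang (transfers k u)
  transfers-inLang zero    u = tt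
  transfers-inLang (suc k) u = transfer-inLang k (u k) , transfers-inLang k u

  successor-inLang : ∀ u → InLang (successor u)
  successor-inLang u = (v₁ , ((v₁ , tt) , tt) , (v₁ , tt , tt) , transfers-inLang K u) , tt

  at-inLang : ∀ ℓ φ → InLang φ → InLang (at ℓ φ)
  at-inLang ℓ φ x = (tt , tt) , v₀ , v₀ , row₀-inLang 1 , v₀ , v₀ , row₀-inLang 0 , value₀-inLang (K + ℓ) , x

  ifZero-inLang : ∀ i φ → InLang φ → InLang (ifZero i φ)
  ifZero-inLang i φ x = v₀ , v₀ , row₀-inLang (suc i) , value₀-inLang K , x

  ifPositive-inLang : ∀ i φ → InLang φ → InLang (ifPositive i φ)
  ifPositive-inLang i φ x =
    v₀ , v₀ , row₀-inLang (suc i) , ((v₁ , value₁-inLang K , less-inLang v₁ v₀ , tt) , tt) , x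

  axioms-inLang : ∀ ℓ Π φ → InLang φ → InLang (axioms ℓ Π φ)
  axioms-inLang ℓ []              φ x = x
  axioms-inLang ℓ (set j s a ∷ Π) φ x =
    at-inLang ℓ (successor (setU j s a)) (successor-inLang (setU j s a)) , axioms-inLang (suc ℓ) Π φ x
  axioms-inLang ℓ (djz i a b ∷ Π) φ x =
    at-inLang ℓ (ifZero i (successor (zeroU a)))
      (ifZero-inLang i (successor (zeroU a)) (successor-inLang (zeroU a))) ,
    at-inLang ℓ (ifPositive i (successor (decU i b)))
      (ifPositive-inLang i (successor (decU i b)) (successor-inLang (decU i b))) ,
    axioms-inLang (suc ℓ) Π φ x

  content-inLang : ∀ j φ → InLang φ → InLang (content j φ)
  content-inLang 0             φ x = value₀-inLang (K + 0)
  content-inLang 1             φ x = x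
  content-inLang (suc (suc j)) φ x = value₀-inLang (K + 0)

  registers-inLang : ∀ j φ → InLang φ → InLang (registers j φ)
  registers-inLang zero    φ x = tt
  registers-inLang (suc j) φ x =
    register-inLang j (content j φ) (content-inLang j φ x) , registers-inLang j φ x

  halting-inLang : ∀ Π φ → InLang φ → InLang (halting Π φ)
  halting-inLang Π φ x =
    at-inLang (length Π) F tt ,
    axioms-inLang 0 Π (start φ ⇒ F) ((((tt , tt) , registers-inLang K φ x) , tt) , tt)

  -- Computability of the reduction.

  op-~ : ∀ {T} → ComputableOp T → ComputableOp (λ φ → ~ T φ)
  op-~ t = op-⇒ t (op-const F)

  op-content : ∀ j → ComputableOp (content j)
  op-content 0             = op-const (value₀ (K + 0))
  op-content 1             = op-id
  op-content (suc (suc j)) = op-const (value₀ (K + 0))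

  op-registers : ∀ j → ComputableOp (registers j)
  op-registers zero    = op-const F
  op-registers (suc j) =
    op-⇒ (op-~ (op-∀ 0 (op-⇒ (op-content j) (op-const (row₀ j ⇒ P 0 ⇒ F))))) (op-registers j)

  op-axioms : ∀ {T} ℓ Π → ComputableOp T → ComputableOp (λ φ → axioms ℓ Π (T φ))
  op-axioms ℓ []              t = t
  op-axioms ℓ (set j s a ∷ Π) t = op-⇒ (op-const (at ℓ (successor (setU j s a)))) (op-axioms (suc ℓ) Π t)
  op-axioms ℓ (djz i a b ∷ Π) t =
    op-⇒ (op-const (at ℓ (ifZero i (successor (zeroU a)))))
      (op-⇒ (op-const (at ℓ (ifPositive i (successor (decU i b))))) (op-axioms (suc ℓ) Π t))

  -- For a fixed program, only the description of the input register varies with the input.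
  op-halting : ∀ Π → ComputableOp (halting Π)
  op-halting Π =
    op-⇒ (op-const (at (length Π) F)) (op-axioms 0 Π (op-~ (op-~ (op-□ (op-⇒ (op-const (~ p)) (op-registers K))))))

op-value-suc : ComputableOp value-suc
op-value-suc =
  op-⇒ (op-∀ 1 (op-⇒ (op-const (geq 0 1)) (op-⇒ (op-const (less 1 0)) (op-⇒ (op-const (cover 1 0))
    (op-⇒ (op-⇒ (op-∀ 0 (op-⇒ (op-const (geq 1 0)) (op-⇒ (op-const (geq 0 1)) (op-⇒ op-id (op-const F)))))
      (op-const F)) (op-const F)))))) (op-const F)

haltingFormula-inLang : ∀ Π n → InLang (haltingFormula Π n)
haltingFormula-inLang Π n =
  halting-inLang (registerBound Π) Π (value₀ (registerBound Π + n)) (value₀-inLang (registerBound Π + n))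

haltingFormula-computable : ∀ Π → ComputableForms (haltingFormula Π)
haltingFormula-computable Π =
  forms-op {Formulas.halting K Π} {λ n → value₀ (K + n)} (op-halting K Π)
    (forms-iterate (λ n → value₀ (K + n)) op-value-suc (λ n → cong value₀ (+-suc K n)))
  where
  K = registerBound Π

theorem4 : ∀ {ℓ : Level} (W : Set) (_<_ : Rel W Level.zero) (R : Rel W Level.zero)
    → IsStrictLinearOrder _<_
    → HasInfiniteAscendingChain _<_
    → (∀ {x y} → x < y → R x y)
    → (∀ {x y} → R x y → ReflClosure _<_ x y)
    → (L : Form → Set ℓ)
    → (∀ φ → LogicExp W R φ → L φ)
    → (∀ φ → L φ → LogicConst W R φ)
    → Pi01Hard (λ φ → InLang φ × ¬ L (¬' φ))
    × Sigma01Hard (λ φ → InLang φ × L φ)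
theorem4 W _<_ R (isSPO , _) (c , c-step , c-injective) <⇒R R⇒≤ L exp⊆L L⊆const = Π-hard , Σ-hard
  where
  <-tr : ∀ {x y z} → x < y → y < z → x < z
  <-tr = IsStrictPartialOrder.trans isSPO

  R-trans : ∀ {x y z} → R x y → R y z → R x z
  R-trans r s with R⇒≤ r | R⇒≤ s
  ... | inj₂ refl | _         = s
  ... | inj₁ _    | inj₂ refl = r
  ... | inj₁ x<y  | inj₁ y<z  = <⇒R (<-tr x<y y<z)

  c-< : ∀ {i j} → i ≤′ j → c i < c (suc j)
  c-< ≤′-refl         = c-step _
  c-< (≤′-step i≤j)   = <-tr (c-< i≤j) (c-step _)

  c-mono : ∀ {i j} → i ℕ.< j → R (c i) (c j)
  c-mono (s≤s i≤j) = <⇒R (c-< (≤⇒≤′ i≤j))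

  valid : ∀ e n → (∃ λ y → Eval e (n ∷ []) y) →
          ∀ {𝓕 : PFrame W R} (𝓜 : Model 𝓕) w g → Sat 𝓜 w g (haltingFormula (program e) n)
  valid e n ev 𝓜 = Simulation.halting-valid R-trans 𝓜 (program e) n (program-correct e n ev)

  module 𝓒 e n = Canonical {R = R} c c-injective c-mono (program e) n

  reflects : ∀ e n {g} → Sat (𝓒.𝓜 e n) (c 0) g (haltingFormula (program e) n) →
             ∃ λ y → Eval e (n ∷ []) y
  reflects e n s = program-correct⁻¹ e n (𝓒.halting-reflects e n s)

  Σ-hard : Sigma01Hard (λ φ → InLang φ × L φ)
  Σ-hard A (e , A⇔) =
    reduction (λ φ → InLang φ × L φ) (haltingFormula (program e)) (haltingFormula-computable (program e)) λ n → mk⇔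
      (λ An → haltingFormula-inLang (program e) n ,
        exp⊆L _ (λ _ M w g _ → valid e n (Equivalence.to (A⇔ n) An) M w g))
      (λ (_ , l) → Equivalence.from (A⇔ n) (reflects e n
        -- The canonical frame has constant domains, so the upper bound on `L` applies to it.
        (L⊆const _ l (𝓒.𝓕 e n) (λ _ _ _ _ → tt) (𝓒.𝓜 e n) (c 0) (λ _ → name 0) (λ _ _ → tt))))

  -- The negated formula serves: `L` contains its negation when the machine halts, and conversely
  -- such membership gives the double negation of halting, enough to contradict divergence.
  Π-hard : Pi01Hard (λ φ → InLang φ × ¬ L (¬' φ))
  Π-hard A (e , A⇔) =
    reduction (λ φ → InLang φ × ¬ L (¬' φ)) (λ n → ¬' (haltingFormula (program e) n))
      (forms-op (op-⇒ op-id (op-const ⊥')) (haltingFormula-computable (program e))) λ n → mk⇔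
      (λ An → (haltingFormula-inLang (program e) n , tt) , λ l →
        L⊆const _ l (𝓒.𝓕 e n) (λ _ _ _ _ → tt) (𝓒.𝓜 e n) (c 0) (λ _ → name 0) (λ _ _ → tt)
          λ s → Equivalence.to (A⇔ n) An (reflects e n s))
      (λ (_ , ¬l) → Equivalence.from (A⇔ n) λ ev →
        ¬l (exp⊆L _ λ _ M w g _ k → k (valid e n ev M w g)))
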